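{- For every integer $n>0$, $$\sum_{k=0}^{n-1}q^{k}C_k^q\equiv\begin{cases} q^{\lfloor n/3\rfloor} & \text{if } n\equiv 0,1 \pmod 3,\\[4pt] -1-q^{(2n-1)/3} & \text{if } n\equiv 2 \pmod 3,\end{cases}\pmod{\Phi_n(q)},$$ as a congruence in $\mathbb{Z}[q]$.
   Context: The Gaussian $q$-binomial coefficient $\binom{n}{k}_q$ is the polynomial in $q$ given by $\binom{n}{k}_q=\dfrac{(q;q)_n}{(q;q)_k(q;q)_{n-k}}$ if $0\le k\le n$ and $\binom{n}{k}_q=0$ otherwise, where $(z;q)_n=\prod_{j=0}^{n-1}(1-zq^j)$. The $q$-Catalan number is the polynomial $C_n^q=\dfrac{1}{[n+1]_q}\binom{2n}{n}_q=\binom{2n}{n}_q-q\binom{2n}{n+1}_q$, where $[n+1]_q=\dfrac{1-q^{n+1}}{1-q}$. $\Phi_n(q)=\prod_{0\le m<n,\ \gcd(m,n)=1}(q-e^{2\pi m i/n})$ is the $n$-th cyclotomic polynomial. -}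

module Defs where

open import Algebra.Apartness.Bundles using (HeytingField; module HeytingField; module HeytingCommutativeRing)
open import Algebra.Bundles using (module CommutativeRing)
open import Algebra.Bundles.Raw using (RawRing)
import Algebra.Definitions.RawMagma as MagmaDefs
import Algebra.Definitions.RawSemiring as SemiringDefs
open import Data.Fin.Base using (Fin; toℕ)
open import Data.Integer.Base as ℤ using (ℤ; +_; -[1+_])
open import Data.List.Base as List using (List; []; _∷_; filter; upTo)
open import Data.Nat.Base as ℕ using (ℕ; zero; suc; NonZero)
open import Data.Nat.DivMod using (_/_; _%_)
open import Data.Nat.GCD using (gcd)
open import Data.Nat.Properties using (_≟_; _≤?_)
open import Data.Product.Base using (_×_)
open import Level using (Level; _⊔_)
open import Relation.Nullary.Decidable using (yes; no)

private
  variable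
    c ℓ ℓ₁ ℓ₂ : Level

-- Univariate polynomials over R: coefficient lists, constant term first.  Lists
-- may end in zeros, so equality is equality of all coefficients.

module Polynomial (R : RawRing c ℓ) where
  open RawRing R

  Poly : Set c
  Poly = List Carrier

  coeff : Poly → ℕ → Carrier
  coeff []      _       = 0#
  coeff (a ∷ p) zero    = a
  coeff (a ∷ p) (suc i) = coeff p i

  infix 4 _≈ₚ_
  _≈ₚ_ : Poly → Poly → Set ℓ
  p ≈ₚ r = ∀ i → coeff p i ≈ coeff r i

  infixl 6 _+ₚ_
  _+ₚ_ : Poly → Poly → Poly
  []      +ₚ r       = r
  (a ∷ p) +ₚ []      = a ∷ p
  (a ∷ p) +ₚ (b ∷ r) = (a + b) ∷ (p +ₚ r)

  infixl 7 _*ₚ_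
  _*ₚ_ : Poly → Poly → Poly
  []      *ₚ r = []
  (a ∷ p) *ₚ r = List.map (a *_) r +ₚ (0# ∷ (p *ₚ r))

  -ₚ_ : Poly → Poly
  -ₚ_ = List.map (-_)

  const : Carrier → Poly
  const a = a ∷ []

  X : Poly
  X = 0# ∷ 1# ∷ []

  polyRawRing : RawRing c ℓ
  polyRawRing = record
    { Carrier = Poly
    ; _≈_     = _≈ₚ_
    ; _+_     = _+ₚ_
    ; _*_     = _*ₚ_
    ; -_      = -ₚ_
    ; 0#      = []
    ; 1#      = const 1#
    }

  -- The first m coefficients of the power series p / d, for d with constant
  -- coefficient 1: writing p = a + X p′ and d = 1 + X d′, one has
  -- p / d = a + X ((p′ - a d′) / d).

  seriesQuotient : ℕ → Poly → Poly → Poly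
  seriesQuotient zero    p d = []
  seriesQuotient (suc m) p d =
    coeff p 0 ∷ seriesQuotient m (List.drop 1 (p +ₚ -ₚ (const (coeff p 0) *ₚ d))) d

  -- The quotient p / d when d divides p and d has constant coefficient 1; over an
  -- integral domain the quotient has degree < length p, so nothing is cut off.

  infixl 7 _÷_
  _÷_ : Poly → Poly → Poly
  p ÷ d = seriesQuotient (List.length p) p d

module ℤ[q] where
  open Polynomial ℤ.+-*-rawRing public using (coeff; _÷_) renaming (X to q)
  private module R = RawRing (Polynomial.polyRawRing ℤ.+-*-rawRing)
  open R public using (_≈_; _+_; _*_; -_; 0#; 1#) renaming (Carrier to ℤ[q])
  open SemiringDefs R.rawSemiring public using (_^_; sum; product)
  open MagmaDefs R.*-rawMagma public using (_∣_)

  infixl 6 _-_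
  _-_ : ℤ[q] → ℤ[q] → ℤ[q]
  p - r = p + - r

  infix 4 _≡_[mod_]
  _≡_[mod_] : ℤ[q] → ℤ[q] → ℤ[q] → Set
  p ≡ r [mod d ] = d ∣ (p - r)

open ℤ[q]

-- (z;q)ₙ
pochhammer : ℤ[q] → ℕ → ℤ[q]
pochhammer z n = product {n} λ j → 1# - z * q ^ toℕ j

-- The divisors here and in the next two definitions have constant coefficient 1,
-- as _÷_ requires.
gaussianBinomial : ℕ → ℕ → ℤ[q]
gaussianBinomial n k with k ≤? n
... | yes _ = pochhammer q n ÷ (pochhammer q k * pochhammer q (n ℕ.∸ k))
... | no  _ = 0#

qInteger : ℕ → ℤ[q]
qInteger n = (1# - q ^ n) ÷ (1# - q)

qCatalan : ℕ → ℤ[q]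
qCatalan n = gaussianBinomial (2 ℕ.* n) n ÷ qInteger (suc n)

catalanSum : ℕ → ℤ[q]
catalanSum n = sum {n} λ k → q ^ toℕ k * qCatalan (toℕ k)

residue : ℕ → ℤ[q]
residue n with n % 3
... | 2 = - 1# - q ^ ((2 ℕ.* n ℕ.∸ 1) / 3)
... | _ = q ^ (n / 3)

-- The library has no complex numbers, so the product defining Φₙ is formed in an
-- arbitrary (Heyting) field K of characteristic zero with a primitive n-th root of
-- unity ζ; the usual definition is the case K = ℂ, ζ = e^{2πi/n}.

module _ (K : HeytingField c ℓ₁ ℓ₂) where
  private
    module K where
      open HeytingField K public
      open CommutativeRing (HeytingCommutativeRing.commutativeRing heytingCommutativeRing) public
        using (rawRing)
      open SemiringDefs (RawRing.rawSemiring rawRing) public using (_^_) renaming (_×_ to _·_)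
    module K[q] where
      open Polynomial K.rawRing public
      open RawRing polyRawRing public using (_≈_; _+_; _*_; -_; 1#)

  CharacteristicZero : Set ℓ₂
  CharacteristicZero = ∀ n → .{{NonZero n}} → (n K.· K.1#) K.# K.0#

  IsPrimitiveRoot : ℕ → K.Carrier → Set (ℓ₁ ⊔ ℓ₂)
  IsPrimitiveRoot n ζ =
    (ζ K.^ n) K.≈ K.1# × (∀ m → 0 ℕ.< m → m ℕ.< n → (ζ K.^ m) K.# K.1#)

  fromℤ : ℤ → K.Carrier
  fromℤ (+ n)    = n K.· K.1#
  fromℤ -[1+ n ] = K.- (suc n K.· K.1#)

  -- ∏ (q - ζᵐ) over 0 ≤ m < n with gcd(m,n) = 1
  cyclotomicProduct : ℕ → K.Carrier → K[q].Poly
  cyclotomicProduct n ζ =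
    List.foldr K[q]._*_ K[q].1#
      (List.map (λ m → K[q].X K[q].+ K[q].- K[q].const (ζ K.^ m))
        (filter (λ m → gcd m n ≟ 1) (upTo n)))

  -- Φ ∈ ℤ[q] is the n-th cyclotomic polynomial.
  IsCyclotomic : ℕ → K.Carrier → ℤ[q] → Set ℓ₁
  IsCyclotomic n ζ Φ = List.map fromℤ Φ K[q].≈ cyclotomicProduct n ζ

{-# OPTIONS --safe #-}
module Submission where

-- At a primitive n-th root of unity ξ, binom(2n, n+i) vanishes for 0 < i < n.  The
-- partial sums S_d(n) = Σ_{k<n} q^k binom(2k, k+d) have an expansion in the numbers
-- binom(2n, n+i), i > d, whose coefficients ± q^(...) do not depend on n, so at ξ only
-- the coefficient of binom(2n, 2n) = 1 survives.  As q^k C_k = q^k binom(2k, k) -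
-- q · q^k binom(2k, k+1), the Catalan sum is S_0(n) - q S_1(n), and reducing exponents
-- modulo n gives its value at ξ.
-- The remainder of the division of (Catalan sum - residue) by the monic polynomial Φₙ
-- has degree less than φ(n) and the φ(n) distinct primitive roots as zeros, so it is 0
-- over K, and by characteristic zero also over ℤ.
open import Algebra.Apartness.Bundles using (HeytingField; module HeytingField; module HeytingCommutativeRing)
open import Algebra.Bundles using (CommutativeRing; Monoid)
open import Algebra.Morphism.Structures using (module RingMorphisms)
import Algebra.Properties.Monoid.Sum
import Algebra.Properties.Ring
import Algebra.Properties.Semiring.Exp
import Algebra.Properties.Semiring.Mult.TCOptimised
import Algebra.Solver.Ring
open import Algebra.Solver.Ring.AlmostCommutativeRing using (fromCommutativeRing; _-Raw-AlmostCommutative⟶_)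
open import Data.Fin.Base using (toℕ)
import Data.Fin.Properties as Finₚ
open import Data.Integer.Base as ℤ using (ℤ; +_; -[1+_]; _⊖_)
import Data.Integer.Properties as ℤₚ
open import Data.List.Base as List using (List; []; _∷_; length; filter; upTo)
open import Data.List.Membership.Propositional using (_∈_)
import Data.List.Properties as Listₚ
open import Data.List.Relation.Unary.All as All using (All; []; _∷_)
import Data.List.Relation.Unary.All.Properties as Allₚ
open import Data.List.Relation.Unary.AllPairs using (AllPairs; []; _∷_)
import Data.List.Relation.Unary.AllPairs.Properties as AllPairsₚ
open import Data.List.Relation.Unary.Any using (here; there)
open import Data.Maybe.Base using (Maybe; just; nothing)
open import Data.Nat.Base as ℕ using (ℕ; zero; suc; z≤n; s≤s; NonZero)
open import Data.Nat.Coprimality as Coprimality using (coprime-divisor; gcd≡1⇒coprime)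
open import Data.Nat.DivMod using (_/_; _%_; m≡m%n+[m/n]*n; m%n<n; m*n/n≡m)
open import Data.Nat.Divisibility using (∣⇒≤; m%n≡0⇒n∣m)
open import Data.Nat.GCD using (gcd)
import Data.Nat.Properties as ℕₚ
import Data.Nat.Tactic.RingSolver as ℕSolver
open import Data.Product.Base using (_×_; _,_; ∃; ∃₂; proj₁; proj₂)
open import Data.Sum.Base as Sum using (_⊎_; inj₁; inj₂)
open import Defs
open import Relation.Binary.PropositionalEquality as ≡ using (_≡_; _≢_)
import Relation.Binary.Reasoning.Setoid
open import Relation.Nullary.Decidable using (yes; no)
open import Relation.Nullary.Negation using (contradiction)
open ℤ[q] using (ℤ[q]; _≡_[mod_])

-- The period 3 is already visible at q = 1. There binom(2n+2, n+1+j) - binom(2n, n+j) is the sum of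
-- binom(2n, n+j-1), binom(2n, n+j) and binom(2n, n+j+1). Coefficients a(j) with S_d(n) = Σ a(j)
-- binom(2n, n+j) should therefore satisfy a(j-1) + a(j) + a(j+1) = 0, except at j = d, where this
-- sum is 1. Starting from zeros, this forces a(d+1), a(d+2), ... to be 1, -1, 0, 1, -1, 0, ... . So
-- n - d modulo 3 decides whether S_d survives at ξ and with which sign. Two obstacles shape the
-- rest. Quotient formulas can become 0/0 at a root of unity, so the evaluation uses the q-Pascal
-- recursion, which ring homomorphisms preserve; it is matched with the quotients only inside ℤ[q].
-- And equality in K cannot be assumed decidable: leading terms are located only over ℤ, while over
-- K the arguments use upper bounds for degrees and non-zero-divisors.

-- The image of ℤ in a commutative ring

module IntegerImage {c ℓ} (R : CommutativeRing c ℓ) where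
  open CommutativeRing R
  open Algebra.Properties.Ring ring
  open Algebra.Properties.Semiring.Mult.TCOptimised semiring renaming (_×_ to infixr 8 _·_)
  open Relation.Binary.Reasoning.Setoid setoid

  -- The optimised multiple makes ⟦ + 1 ⟧ definitionally 1#, so that the solver
  -- recognises numerals.
  ⟦_⟧ : ℤ → Carrier
  ⟦ + n ⟧      = n · 1#
  ⟦ -[1+ n ] ⟧ = - (suc n · 1#)

  ⟦-⟧ : ∀ i → ⟦ ℤ.- i ⟧ ≈ - ⟦ i ⟧
  ⟦-⟧ (+ zero)   = sym -0#≈0#
  ⟦-⟧ (+ suc n)  = refl
  ⟦-⟧ (-[1+ n ]) = sym (-‿involutive _)

  private
    cancel-1 : ∀ a b → a - b ≈ (1# + a) - (1# + b)
    cancel-1 a b = begin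
      a - b                    ≈⟨ +-congʳ (xyx⁻¹≈y 1# a) ⟨
      (1# + a - 1#) - b        ≈⟨ +-assoc _ _ _ ⟩
      (1# + a) + (- 1# - b)    ≈⟨ +-congˡ (-‿+-comm 1# b) ⟩
      (1# + a) - (1# + b)      ∎

  ⟦⊖⟧ : ∀ m n → ⟦ m ⊖ n ⟧ ≈ m · 1# - n · 1#
  ⟦⊖⟧ m       zero    = sym (trans (+-congˡ -0#≈0#) (+-identityʳ _))
  ⟦⊖⟧ zero    (suc n) = sym (+-identityˡ _)
  ⟦⊖⟧ (suc m) (suc n) = begin
    ⟦ suc m ⊖ suc n ⟧              ≡⟨ ≡.cong ⟦_⟧ (ℤₚ.[1+m]⊖[1+n]≡m⊖n m n) ⟩
    ⟦ m ⊖ n ⟧                      ≈⟨ ⟦⊖⟧ m n ⟩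
    m · 1# - n · 1#                ≈⟨ cancel-1 _ _ ⟩
    (1# + m · 1#) - (1# + n · 1#)  ≈⟨ +-cong (1+× m 1#) (-‿cong (1+× n 1#)) ⟨
    suc m · 1# - suc n · 1#        ∎

  ⟦+⟧ : ∀ i j → ⟦ i ℤ.+ j ⟧ ≈ ⟦ i ⟧ + ⟦ j ⟧
  ⟦+⟧ (+ m)      (+ n)      = ×-homo-+ 1# m n
  ⟦+⟧ (+ m)      (-[1+ n ]) = ⟦⊖⟧ m (suc n)
  ⟦+⟧ (-[1+ m ]) (+ n)      = trans (⟦⊖⟧ n (suc m)) (+-comm _ _)
  ⟦+⟧ (-[1+ m ]) (-[1+ n ]) = begin
    - (suc (suc (m ℕ.+ n)) · 1#)       ≡⟨ ≡.cong (λ k → - (suc k · 1#)) (≡.sym (ℕₚ.+-suc m n)) ⟩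
    - ((suc m ℕ.+ suc n) · 1#)         ≈⟨ -‿cong (×-homo-+ 1# (suc m) (suc n)) ⟩
    - (suc m · 1# + suc n · 1#)        ≈⟨ -‿+-comm _ _ ⟨
    - (suc m · 1#) - (suc n · 1#)      ∎

  private
    ⟦+*⟧ : ∀ m j → ⟦ + m ℤ.* j ⟧ ≈ m · 1# * ⟦ j ⟧
    ⟦+*⟧ m (+ n)      = trans (reflexive (≡.cong ⟦_⟧ (≡.sym (ℤₚ.pos-* m n)))) (×1-homo-* m n)
    ⟦+*⟧ m (-[1+ n ]) = begin
      ⟦ + m ℤ.* ℤ.- (+ suc n) ⟧      ≡⟨ ≡.cong ⟦_⟧ (≡.sym (ℤₚ.neg-distribʳ-* (+ m) (+ suc n))) ⟩
      ⟦ ℤ.- (+ m ℤ.* + suc n) ⟧      ≈⟨ ⟦-⟧ (+ m ℤ.* + suc n) ⟩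
      - ⟦ + m ℤ.* + suc n ⟧          ≡⟨ ≡.cong (λ i → - ⟦ i ⟧) (≡.sym (ℤₚ.pos-* m (suc n))) ⟩
      - ((m ℕ.* suc n) · 1#)         ≈⟨ -‿cong (×1-homo-* m (suc n)) ⟩
      - (m · 1# * suc n · 1#)        ≈⟨ -‿distribʳ-* _ _ ⟩
      m · 1# * - (suc n · 1#)        ∎

  ⟦*⟧ : ∀ i j → ⟦ i ℤ.* j ⟧ ≈ ⟦ i ⟧ * ⟦ j ⟧
  ⟦*⟧ (+ m)      j = ⟦+*⟧ m j
  ⟦*⟧ (-[1+ m ]) j = begin
    ⟦ ℤ.- (+ suc m) ℤ.* j ⟧      ≡⟨ ≡.cong ⟦_⟧ (≡.sym (ℤₚ.neg-distribˡ-* (+ suc m) j)) ⟩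
    ⟦ ℤ.- (+ suc m ℤ.* j) ⟧      ≈⟨ ⟦-⟧ (+ suc m ℤ.* j) ⟩
    - ⟦ + suc m ℤ.* j ⟧          ≈⟨ -‿cong (⟦+*⟧ (suc m) j) ⟩
    - (suc m · 1# * ⟦ j ⟧)       ≈⟨ -‿distribˡ-* _ _ ⟩
    - (suc m · 1#) * ⟦ j ⟧       ∎

  morphism : ℤ.+-*-rawRing -Raw-AlmostCommutative⟶ fromCommutativeRing R
  morphism = record
    { ⟦_⟧ = ⟦_⟧ ; +-homo = ⟦+⟧ ; *-homo = ⟦*⟧ ; -‿homo = ⟦-⟧ ; 0-homo = refl ; 1-homo = refl }

  private
    decide : ∀ i j → Maybe (⟦ i ⟧ ≈ ⟦ j ⟧)
    decide i j with i ℤₚ.≟ j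
    ... | yes i≡j = just (reflexive (≡.cong ⟦_⟧ i≡j))
    ... | no  _   = nothing

  module Solver = Algebra.Solver.Ring ℤ.+-*-rawRing (fromCommutativeRing R) morphism decide

-- q-binomial coefficients

module RangeSum {c ℓ} (M : Monoid c ℓ) where
  open Monoid M renaming (_∙_ to _+_; ∙-cong to +-cong)
  open Algebra.Properties.Monoid.Sum M using (sum; sum-init-last; sum-cong-≋)

  ∑ : ℕ → (ℕ → Carrier) → Carrier
  ∑ n f = sum {n} (λ i → f (toℕ i))

  ∑-suc : ∀ n f → ∑ (suc n) f ≈ ∑ n f + f n
  ∑-suc n f = trans (sum-init-last (λ i → f (toℕ i)))
    (+-cong (sum-cong-≋ {n} (λ i → reflexive (≡.cong f (Finₚ.toℕ-inject₁ i))))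
            (reflexive (≡.cong f (Finₚ.toℕ-fromℕ n))))

  ∑-cong : ∀ n {f g} → (∀ k → f k ≈ g k) → ∑ n f ≈ ∑ n g
  ∑-cong n f≈g = sum-cong-≋ {n} (λ i → f≈g (toℕ i))

module RingLemmas {c ℓ} (R : CommutativeRing c ℓ) where
  open CommutativeRing R hiding (zero)
  open Algebra.Properties.Semiring.Exp semiring
  open RangeSum +-monoid public
  open IntegerImage R using (module Solver)
  open Solver

  x≈y⇒x-y≈0 : ∀ {x y} → x ≈ y → x - y ≈ 0#
  x≈y⇒x-y≈0 {x} {y} x≈y = trans (+-congʳ x≈y) (-‿inverseʳ y)

  x-y≈0⇒x≈y : ∀ {x y} → x - y ≈ 0# → x ≈ y
  x-y≈0⇒x≈y {x} {y} x-y≈0 =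
    trans (solve 2 (λ x y → x := (x :- y) :+ y) refl x y) (trans (+-congʳ x-y≈0) (+-identityˡ y))

  -- Reduces x ≈ y modulo the relation l ≈ r to an identity for the ring solver.
  substitute : ∀ {x y} c {l r} → l ≈ r → x ≈ y + c * (l - r) → x ≈ y
  substitute c l≈r x≈ =
    trans x≈ (trans (+-congˡ (trans (*-congˡ (x≈y⇒x-y≈0 l≈r)) (zeroʳ c))) (+-identityʳ _))

  ^-*-unit : ∀ x n b → x ^ n ≈ 1# → x ^ (n ℕ.* b) ≈ 1#
  ^-*-unit x n b x^n≈1 = trans (sym (^-assocʳ x n b)) (trans (^-congˡ b x^n≈1) (1^ b))
    where
    1^ : ∀ b → 1# ^ b ≈ 1#
    1^ zero    = refl
    1^ (suc b) = trans (*-identityˡ _) (1^ b)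

  ∑-last : ∀ n f → (∀ k → k ℕ.< n → f k ≈ 0#) → ∑ (suc n) f ≈ f n
  ∑-last n f f≈0 = trans (∑-suc n f) (trans (+-congʳ (vanish n (λ k → f≈0 k))) (+-identityˡ _))
    where
    vanish : ∀ n → (∀ k → k ℕ.< n → f k ≈ 0#) → ∑ n f ≈ 0#
    vanish zero    _   = refl
    vanish (suc n) f≈0 = trans (∑-suc n f)
      (trans (+-cong (vanish n (λ k k<n → f≈0 k (ℕₚ.m<n⇒m<1+n k<n))) (f≈0 n ℕₚ.≤-refl)) (+-identityʳ 0#))

module QBinomial {c ℓ} (R : CommutativeRing c ℓ) (q : CommutativeRing.Carrier R) where
  open CommutativeRing R hiding (zero)
  open Algebra.Properties.Ring ring
  open Algebra.Properties.Semiring.Exp semiring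
  open RangeSum *-monoid renaming (∑ to ∏; ∑-suc to ∏-suc)
  open RingLemmas R
  open IntegerImage R using (module Solver)
  open Solver

  -- The q-Pascal rule involves no division, so it makes sense in every commutative ring and at
  -- every q, and `qbinom-homo` is a plain induction.
  qbinom : ℕ → ℕ → Carrier
  qbinom n       zero    = 1#
  qbinom zero    (suc k) = 0#
  qbinom (suc n) (suc k) = qbinom n k + q ^ suc k * qbinom n (suc k)

  qbinom-above : ∀ {n k} → n ℕ.< k → qbinom n k ≈ 0#
  qbinom-above {zero}  {suc k} _         = refl
  qbinom-above {suc n} {suc k} (s≤s n<k) =
    trans (+-cong (qbinom-above n<k) (trans (*-congˡ (qbinom-above (ℕₚ.m<n⇒m<1+n n<k))) (zeroʳ _)))
          (+-identityʳ 0#)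

  qbinom-diagonal : ∀ n → qbinom n n ≈ 1#
  qbinom-diagonal zero    = refl
  qbinom-diagonal (suc n) =
    trans (+-cong (qbinom-diagonal n) (trans (*-congˡ (qbinom-above (ℕₚ.n<1+n n))) (zeroʳ _)))
          (+-identityʳ 1#)

  -- [k+1] binom(n,k+1) = [n-k] binom(n,k), cleared of the truncated difference n - k.
  qbinom-ratio : ∀ n k →
    q ^ k * (1# - q ^ suc k) * qbinom n (suc k) ≈ (q ^ k - q ^ n) * qbinom n k
  qbinom-ratio zero    zero    = solve 1 (λ q → con (+ 1) :* (con (+ 1) :- q :* con (+ 1)) :* con (+ 0)
                                   := (con (+ 1) :- con (+ 1)) :* con (+ 1)) refl q
  qbinom-ratio zero    (suc k) = trans (zeroʳ _) (sym (zeroʳ _))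
  qbinom-ratio (suc n) zero    = substitute q (qbinom-ratio n zero)
    (solve 3 (λ q y g → con (+ 1) :* (con (+ 1) :- q :* con (+ 1)) :* (con (+ 1) :+ q :* con (+ 1) :* g)
      := (con (+ 1) :- q :* y) :* con (+ 1)
         :+ q :* (con (+ 1) :* (con (+ 1) :- q :* con (+ 1)) :* g :- (con (+ 1) :- y) :* con (+ 1)))
      refl q (q ^ n) (qbinom n 1))
  qbinom-ratio (suc n) (suc k) = substitute q (qbinom-ratio n k) (substitute (q * q * q ^ k) (qbinom-ratio n (suc k))
    (solve 6 (λ q x y g₀ g₁ g₂ → let 1ₚ = con (+ 1) in
      q :* x :* (1ₚ :- q :* (q :* x)) :* (g₁ :+ q :* (q :* x) :* g₂)
      := (q :* x :- q :* y) :* (g₀ :+ q :* x :* g₁)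
         :+ q :* (x :* (1ₚ :- q :* x) :* g₁ :- (x :- y) :* g₀)
         :+ q :* q :* x :* (q :* x :* (1ₚ :- q :* (q :* x)) :* g₂ :- (q :* x :- y) :* g₁))
      refl q (q ^ k) (q ^ n) (qbinom n k) (qbinom n (suc k)) (qbinom n (suc (suc k)))))

  -- Spelled with factors 1 - q q^k so that over ℤ[q] it unfolds to `pochhammer q n`.
  qPochhammer : ℕ → Carrier
  qPochhammer n = ∏ n (λ k → 1# - q * q ^ k)

  qPochhammer-suc : ∀ n → qPochhammer (suc n) ≈ qPochhammer n * (1# - q * q ^ n)
  qPochhammer-suc n = ∏-suc n (λ k → 1# - q * q ^ k)

  -- Induction along the q-Pascal rule; the two inductive values combine by 1 - q^(a+b) = (1 - q^a)
  -- + q^a (1 - q^b) with a = k+1, b = l+1. Writing the upper index as k + l avoids a truncated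
  -- difference.
  qbinom-pochhammer : ∀ k l → qbinom (k ℕ.+ l) k * (qPochhammer k * qPochhammer l) ≈ qPochhammer (k ℕ.+ l)
  qbinom-pochhammer zero    l       = trans (*-identityˡ _) (*-identityˡ _)
  qbinom-pochhammer (suc k) zero    rewrite ℕₚ.+-identityʳ k =
    trans (*-cong (qbinom-diagonal (suc k)) (*-identityʳ _)) (*-identityˡ _)
  qbinom-pochhammer (suc k) (suc l) rewrite ℕₚ.+-suc k l = begin
    (g₀ + q * x * g₁) * (qPochhammer (suc k) * qPochhammer (suc l))
      ≈⟨ *-congˡ (*-cong (qPochhammer-suc k) (qPochhammer-suc l)) ⟩
    (g₀ + q * x * g₁) * ((pₖ * (1# - q * x)) * (pₗ * (1# - q * y)))
      ≈⟨ solve 7 (λ q g₀ x g₁ pₖ pₗ y → let 1ₚ = con (+ 1) in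
           (g₀ :+ q :* x :* g₁) :* ((pₖ :* (1ₚ :- q :* x)) :* (pₗ :* (1ₚ :- q :* y)))
           := (1ₚ :- q :* x) :* (g₀ :* (pₖ :* (pₗ :* (1ₚ :- q :* y))))
              :+ q :* x :* (1ₚ :- q :* y) :* (g₁ :* ((pₖ :* (1ₚ :- q :* x)) :* pₗ)))
           refl q g₀ x g₁ pₖ pₗ y ⟩
    (1# - q * x) * (g₀ * (pₖ * (pₗ * (1# - q * y)))) + q * x * (1# - q * y) * (g₁ * ((pₖ * (1# - q * x)) * pₗ))
      ≈⟨ +-cong (*-congˡ (trans (*-congˡ (*-congˡ (sym (qPochhammer-suc l)))) ih₀))
                (*-congˡ (trans (*-congˡ (*-congʳ (sym (qPochhammer-suc k)))) (qbinom-pochhammer (suc k) l))) ⟩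
    (1# - q * x) * p + q * x * (1# - q * y) * p
      ≈⟨ solve 4 (λ q x y p → let 1ₚ = con (+ 1) in
           (1ₚ :- q :* x) :* p :+ q :* x :* (1ₚ :- q :* y) :* p := p :* (1ₚ :- q :* (q :* (x :* y))))
           refl q x y p ⟩
    p * (1# - q * (q * (x * y)))
      ≈⟨ *-congˡ (+-congˡ (-‿cong (*-congˡ (*-congˡ (^-homo-* q k l))))) ⟨
    p * (1# - q * q ^ suc (k ℕ.+ l))
      ≈⟨ qPochhammer-suc (suc (k ℕ.+ l)) ⟨
    qPochhammer (suc (suc (k ℕ.+ l))) ∎
    where
    open Relation.Binary.Reasoning.Setoid setoid
    x  = q ^ k
    y  = q ^ l
    pₖ = qPochhammer k
    pₗ = qPochhammer l
    p  = qPochhammer (suc (k ℕ.+ l))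
    g₀ = qbinom (suc (k ℕ.+ l)) k
    g₁ = qbinom (suc (k ℕ.+ l)) (suc k)
    ih₀ : g₀ * (pₖ * qPochhammer (suc l)) ≈ p
    ih₀ = ≡.subst (λ n → qbinom n k * (pₖ * qPochhammer (suc l)) ≈ qPochhammer n)
                  (ℕₚ.+-suc k l) (qbinom-pochhammer k (suc l))

  geometric : ∀ n → ∑ n (q ^_) * (1# - q) ≈ 1# - q ^ n
  geometric zero    = trans (zeroˡ _) (sym (-‿inverseʳ 1#))
  geometric (suc n) = trans (*-congʳ (∑-suc n (q ^_))) (trans (distribʳ _ _ _) (trans (+-congʳ (geometric n))
    (solve 2 (λ q x → (con (+ 1) :- x) :+ x :* (con (+ 1) :- q) := con (+ 1) :- q :* x) refl q (q ^ n))))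

  -- central n i = binom(2n, n+i)
  central : ℕ → ℕ → Carrier
  central n i = qbinom (n ℕ.+ n) (i ℕ.+ n)

  central-above : ∀ {n i} → n ℕ.< i → central n i ≈ 0#
  central-above {n} n<i = qbinom-above (ℕₚ.+-monoˡ-< n n<i)

  -- Two applications of the q-Pascal rule; at q = 1 the coefficients become 1, 2, 1.
  central-suc : ∀ n i → let x = q ^ i * q ^ n in
    central (suc n) (suc i) ≈
    central n i + (q + q * q) * x * central n (suc i) + q ^ 4 * (x * x) * central n (suc (suc i))
  central-suc n i rewrite ℕₚ.+-suc n n | ℕₚ.+-suc i n =
    trans
      (solve 5 (λ q x g₀ g₁ g₂ →
        (g₀ :+ q :* x :* g₁) :+ q :* (q :* x) :* (g₁ :+ q :* (q :* x) :* g₂)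
        := g₀ :+ (q :+ q :* q) :* x :* g₁ :+ q :^ 4 :* (x :* x) :* g₂)
        refl q (q ^ (i ℕ.+ n)) (central n i) (central n (suc i)) (central n (suc (suc i))))
      (+-cong (+-congˡ (*-congʳ (*-congˡ x≈))) (*-congʳ (*-congˡ (*-cong x≈ x≈))))
    where
    x≈ = ^-homo-* q i n

  module Regular (q-cancel : ∀ {x y} → q * x ≈ q * y → x ≈ y) where

    ^-cancel : ∀ n {x y} → q ^ n * x ≈ q ^ n * y → x ≈ y
    ^-cancel zero    1x≈1y = trans (sym (*-identityˡ _)) (trans 1x≈1y (*-identityˡ _))
    ^-cancel (suc n) eq    = ^-cancel n (q-cancel (trans (sym (*-assoc _ _ _)) (trans eq (*-assoc _ _ _))))

    -- This is `qbinom-ratio` at (2n, n+i) with the common factor q^n cancelled, which is where q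
    -- must be a non-zero-divisor.
    central-ratio : ∀ n i →
      q ^ i * (1# - q * (q ^ i * q ^ n)) * central n (suc i) ≈ (q ^ i - q ^ n) * central n i
    central-ratio n i = ^-cancel n (begin
      t * (z * (1# - q * (z * t)) * g₁)   ≈⟨ solve 4 (λ q z t g → t :* (z :* (con (+ 1) :- q :* (z :* t)) :* g)
                                             := z :* t :* (con (+ 1) :- q :* (z :* t)) :* g) refl q z t g₁ ⟩
      z * t * (1# - q * (z * t)) * g₁     ≈⟨ *-congʳ (*-cong zt (+-congˡ (-‿cong (*-congˡ zt)))) ⟩
      q ^ (i ℕ.+ n) * (1# - q ^ suc (i ℕ.+ n)) * g₁
                                          ≈⟨ qbinom-ratio (n ℕ.+ n) (i ℕ.+ n) ⟩
      (q ^ (i ℕ.+ n) - q ^ (n ℕ.+ n)) * g₀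
                                          ≈⟨ *-congʳ (+-cong (sym zt) (-‿cong (^-homo-* q n n))) ⟩
      (z * t - t * t) * g₀                ≈⟨ solve 3 (λ z t g → (z :* t :- t :* t) :* g := t :* ((z :- t) :* g)) refl z t g₀ ⟩
      t * ((z - t) * g₀)                  ∎)
      where
      open Relation.Binary.Reasoning.Setoid setoid
      z = q ^ i
      t = q ^ n
      g₀ = central n i
      g₁ = central n (suc i)
      zt = sym (^-homo-* q i n)

    -- By `central-ratio` at i = 0, (1 - q^(n+1)) c₁ = (1 - q^n) c₀, so (c₀ - q c₁)(1 - q^(n+1))
    -- collapses to c₀ (1 - q). This reconciles the two formulas for the q-Catalan number, up to a
    -- factor 1 - q that is cancelled in ℤ[q].
    catalan-difference : ∀ n {[n+1]} → [n+1] * (1# - q) ≈ 1# - q ^ suc n →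
      (central n 0 - q * central n 1) * [n+1] * (1# - q) ≈ central n 0 * (1# - q)
    catalan-difference n {[n+1]} geom = begin
      (c₀ - q * c₁) * [n+1] * (1# - q)        ≈⟨ *-assoc _ _ _ ⟩
      (c₀ - q * c₁) * ([n+1] * (1# - q))      ≈⟨ *-congˡ geom ⟩
      (c₀ - q * c₁) * (1# - q * t)            ≈⟨ substitute (- q) (central-ratio n 0)
        (solve 4 (λ q t c₀ c₁ → let 1ₚ = con (+ 1) in
          (c₀ :- q :* c₁) :* (1ₚ :- q :* t)
          := c₀ :* (1ₚ :- q) :+ :- q :* (1ₚ :* (1ₚ :- q :* (1ₚ :* t)) :* c₁ :- (1ₚ :- t) :* c₀))
          refl q t c₀ c₁) ⟩
      c₀ * (1# - q)                           ∎
      where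
      open Relation.Binary.Reasoning.Setoid setoid
      t  = q ^ n
      c₀ = central n 0
      c₁ = central n 1

    -- The q-analogue of one period 1, -1, 0 of coefficients. The power q^(3+2i) is what lets the
    -- middle terms cancel in `pair-suc`.
    pair : ℕ → ℕ → Carrier
    pair n i = central n (suc i) - q ^ 3 * (q ^ i * q ^ i) * central n (suc (suc i))

    -- The two middle terms of the expansions by central-suc cancel by central-ratio; the
    -- outer ones are three indices apart, so that sums over i ≡ d (mod 3) telescope.
    pair-suc : ∀ n i →
      q ^ i * pair (suc n) i ≈
      q ^ i * pair n i + q ^ n * (central n i - q ^ 6 * (q ^ i) ^ 4 * central n (suc (suc (suc i))))
    pair-suc n i =
      trans (*-congˡ (+-cong (central-suc n i) (-‿cong (*-congˡ (central-suc n (suc i))))))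
      (substitute (- 1#) (central-ratio n i)
      (substitute (q * q * (z * z)) (central-ratio n (suc i))
      (substitute (q ^ 4 * (t * z ^ 3)) (central-ratio n (suc (suc i)))
      (solve 7 (λ q z t g₀ g₁ g₂ g₃ → let 1ₚ = con (+ 1) in
        z :* ((g₀ :+ (q :+ q :* q) :* (z :* t) :* g₁ :+ q :^ 4 :* ((z :* t) :* (z :* t)) :* g₂)
              :- q :^ 3 :* (z :* z) :* (g₁ :+ (q :+ q :* q) :* ((q :* z) :* t) :* g₂
                                        :+ q :^ 4 :* (((q :* z) :* t) :* ((q :* z) :* t)) :* g₃))
        := z :* (g₁ :- q :^ 3 :* (z :* z) :* g₂) :+ t :* (g₀ :- q :^ 6 :* z :^ 4 :* g₃)
           :+ (:- 1ₚ) :* (z :* (1ₚ :- q :* (z :* t)) :* g₁ :- (z :- t) :* g₀)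
           :+ q :* q :* (z :* z) :* (q :* z :* (1ₚ :- q :* (q :* z :* t)) :* g₂ :- (q :* z :- t) :* g₁)
           :+ q :^ 4 :* (t :* z :^ 3) :* (q :* (q :* z) :* (1ₚ :- q :* (q :* (q :* z) :* t)) :* g₃ :- (q :* (q :* z) :- t) :* g₂))
        refl q z t (central n i) (central n (suc i)) (central n (suc (suc i))) (central n (suc (suc (suc i))))))))
      where
      z = q ^ i
      t = q ^ n

    -- The solution of the recurrence weight-suc, which makes weight · pair-suc telescope.
    weight : ℕ → ℕ → Carrier
    weight d m = q ^ (6 ℕ.* (m ℕ.* m) ℕ.+ 4 ℕ.* (d ℕ.* m))

    weight-suc : ∀ d m → weight d (suc m) ≈ weight d m * (q ^ 6 * (q ^ (m ℕ.* 3 ℕ.+ d)) ^ 4)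
    weight-suc d m = begin
      weight d (suc m)                            ≡⟨ ≡.cong (q ^_) (exponents d m) ⟩
      q ^ (e ℕ.+ (6 ℕ.+ i ℕ.* 4))                 ≈⟨ ^-homo-* q e (6 ℕ.+ i ℕ.* 4) ⟩
      weight d m * q ^ (6 ℕ.+ i ℕ.* 4)            ≈⟨ *-congˡ (^-homo-* q 6 (i ℕ.* 4)) ⟩
      weight d m * (q ^ 6 * q ^ (i ℕ.* 4))        ≈⟨ *-congˡ (*-congˡ (^-assocʳ q i 4)) ⟨
      weight d m * (q ^ 6 * (q ^ i) ^ 4)          ∎
      where
      open Relation.Binary.Reasoning.Setoid setoid
      e = 6 ℕ.* (m ℕ.* m) ℕ.+ 4 ℕ.* (d ℕ.* m)
      i = m ℕ.* 3 ℕ.+ d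
      exponents : ∀ d m → 6 ℕ.* (suc m ℕ.* suc m) ℕ.+ 4 ℕ.* (d ℕ.* suc m)
                ≡ (6 ℕ.* (m ℕ.* m) ℕ.+ 4 ℕ.* (d ℕ.* m)) ℕ.+ (6 ℕ.+ (m ℕ.* 3 ℕ.+ d) ℕ.* 4)
      exponents = ℕSolver.solve-∀

    weightedPair : ℕ → ℕ → ℕ → Carrier
    weightedPair d n m = weight d m * (q ^ (m ℕ.* 3 ℕ.+ d) * pair n (m ℕ.* 3 ℕ.+ d))

    -- In `pair-suc` the index i+3 is that of the next pair, and by `weight-suc` its coefficient
    -- times the present weight is the next weight. The sum over m telescopes to its two ends.
    ∑-weightedPair-suc : ∀ d n M →
      ∑ M (weightedPair d (suc n)) ≈
      ∑ M (weightedPair d n) + q ^ n * (central n d - weight d M * central n (M ℕ.* 3 ℕ.+ d))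
    ∑-weightedPair-suc d n zero rewrite ℕₚ.*-zeroʳ d =
      solve 2 (λ t g → con (+ 0) := con (+ 0) :+ t :* (g :- con (+ 1) :* g)) refl (q ^ n) (central n d)
    ∑-weightedPair-suc d n (suc M) = begin
      ∑ (suc M) (weightedPair d (suc n))
        ≈⟨ ∑-suc M (weightedPair d (suc n)) ⟩
      ∑ M (weightedPair d (suc n)) + w * (q ^ i * pair (suc n) i)
        ≈⟨ +-cong (∑-weightedPair-suc d n M) (*-congˡ (pair-suc n i)) ⟩
      (s + t * (g - w * g₀)) + w * (p + t * (g₀ - u * g₃))
        ≈⟨ solve 8 (λ s t g w g₀ p u g₃ →
             (s :+ t :* (g :- w :* g₀)) :+ w :* (p :+ t :* (g₀ :- u :* g₃))
             := (s :+ w :* p) :+ t :* (g :- w :* u :* g₃)) refl s t g w g₀ p u g₃ ⟩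
      (s + w * p) + t * (g - w * u * g₃)
        ≈⟨ +-cong (sym (∑-suc M (weightedPair d n)))
                  (*-congˡ (+-congˡ (-‿cong (*-congʳ (sym (weight-suc d M)))))) ⟩
      ∑ (suc M) (weightedPair d n) + t * (g - weight d (suc M) * g₃) ∎
      where
      open Relation.Binary.Reasoning.Setoid setoid
      i  = M ℕ.* 3 ℕ.+ d
      s  = ∑ M (weightedPair d n)
      t  = q ^ n
      w  = weight d M
      u  = q ^ 6 * (q ^ i) ^ 4
      p  = q ^ i * pair n i
      g  = central n d
      g₀ = central n i
      g₃ = central n (suc (suc (suc i)))

    -- Induction on n with M fixed: both sides grow by q^n `central n d`, because the upper end of
    -- the telescope is a binomial whose lower index exceeds 2n as long as n < 3M + d.
    ∑-central : ∀ d M n → n ℕ.≤ M ℕ.* 3 ℕ.+ d →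
      ∑ n (λ k → q ^ k * central k d) ≈ ∑ M (weightedPair d n)
    ∑-central d M zero    _  = sym (vanish M)
      where
      -- At n = 0 both entries of a pair are binom(0, k) with k > 0, which compute to 0.
      pair-zero : ∀ w z c → w * (z * (0# - c * 0#)) ≈ 0#
      pair-zero = solve 3 (λ w z c → w :* (z :* (con (+ 0) :- c :* con (+ 0))) := con (+ 0)) refl
      vanish : ∀ M → ∑ M (weightedPair d 0) ≈ 0#
      vanish zero    = refl
      vanish (suc M) = trans (∑-suc M (weightedPair d 0))
        (trans (+-cong (vanish M) (pair-zero _ _ _)) (+-identityʳ 0#))
    ∑-central d M (suc n) n<i = begin
      ∑ (suc n) (λ k → q ^ k * central k d)
        ≈⟨ ∑-suc n (λ k → q ^ k * central k d) ⟩
      ∑ n (λ k → q ^ k * central k d) + q ^ n * central n d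
        ≈⟨ +-cong (∑-central d M n (ℕₚ.<⇒≤ n<i)) (*-congˡ boundary) ⟩
      ∑ M (weightedPair d n) + q ^ n * (central n d - weight d M * central n (M ℕ.* 3 ℕ.+ d))
        ≈⟨ ∑-weightedPair-suc d n M ⟨
      ∑ M (weightedPair d (suc n)) ∎
      where
      open Relation.Binary.Reasoning.Setoid setoid
      boundary : central n d ≈ central n d - weight d M * central n (M ℕ.* 3 ℕ.+ d)
      boundary = sym (trans (+-congˡ (-‿cong (trans (*-congˡ (central-above n<i)) (zeroʳ _))))
                     (trans (+-congˡ -0#≈0#) (+-identityʳ _)))

  -- Values at a primitive root of unity

  module AtRootOfUnity (ν : ℕ) (q^n≈1 : q ^ suc ν ≈ 1#)
    (regular : ∀ i → 0 ℕ.< i → i ℕ.< suc ν → ∀ {x} → (1# - q ^ i) * x ≈ 0# → x ≈ 0#) where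

    private
      n = suc ν

      q-cancel : ∀ {x y} → q * x ≈ q * y → x ≈ y
      q-cancel {x} {y} qx≈qy = trans (sym (rotate x)) (trans (*-congˡ qx≈qy) (rotate y))
        where
        rotate : ∀ x → q ^ ν * (q * x) ≈ x
        rotate x = trans (solve 3 (λ a q x → a :* (q :* x) := q :* a :* x) refl (q ^ ν) q x)
                         (trans (*-congʳ q^n≈1) (*-identityˡ x))

    open Regular q-cancel

    -- With q^n = 1 the left factor in `central-ratio` is the non-zero-divisor 1 - q^(i+1). The
    -- right side vanishes by induction for i > 0; for i = 0 it is the factor 1 - q^n that vanishes,
    -- as binom(2n, n) need not.
    central-middle : ∀ i → suc i ℕ.< n → central n (suc i) ≈ 0#
    central-middle i i<n = regular (suc i) (s≤s z≤n) i<n (^-cancel i (begin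
      q ^ i * ((1# - q * q ^ i) * central n (suc i))
        ≈⟨ solve 3 (λ z y g → z :* ((con (+ 1) :- y) :* g) := z :* (con (+ 1) :- y) :* g) refl _ _ _ ⟩
      q ^ i * (1# - q * q ^ i) * central n (suc i)
        ≈⟨ *-congʳ (*-congˡ (+-congˡ (-‿cong (*-congˡ (trans (*-congˡ q^n≈1) (*-identityʳ _)))))) ⟨
      q ^ i * (1# - q * (q ^ i * q ^ n)) * central n (suc i)
        ≈⟨ central-ratio n i ⟩
      (q ^ i - q ^ n) * central n i
        ≈⟨ vanish i (ℕₚ.<-trans (ℕₚ.n<1+n i) i<n) ⟩
      0#
        ≈⟨ zeroʳ _ ⟨
      q ^ i * 0# ∎))
      where
      open Relation.Binary.Reasoning.Setoid setoid
      vanish : ∀ i → i ℕ.< n → (q ^ i - q ^ n) * central n i ≈ 0#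
      vanish zero    _   = trans (*-congʳ (x≈y⇒x-y≈0 (sym q^n≈1))) (zeroˡ _)
      vanish (suc i) i<n = trans (*-congˡ (central-middle i i<n)) (zeroʳ _)

    q^-periodic : ∀ a b → q ^ (a ℕ.+ n ℕ.* b) ≈ q ^ a
    q^-periodic a b = begin
      q ^ (a ℕ.+ n ℕ.* b)      ≈⟨ ^-homo-* q a (n ℕ.* b) ⟩
      q ^ a * q ^ (n ℕ.* b)    ≈⟨ *-congˡ (^-*-unit q n b q^n≈1) ⟩
      q ^ a * 1#               ≈⟨ *-identityʳ _ ⟩
      q ^ a                    ∎
      where
      open Relation.Binary.Reasoning.Setoid setoid

    private
      -- The pair involves the lower indices n+i+1 and n+i+2. This lemma and the next three place
      -- the top index 2n beyond both, at the second, at the first, and below both.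
      pair-middle : ∀ i → suc (suc i) ℕ.< n → pair n i ≈ 0#
      pair-middle i i<n = trans
        (+-cong (central-middle i (ℕₚ.<⇒≤ i<n)) (-‿cong (*-congˡ (central-middle (suc i) i<n))))
        (solve 1 (λ c → con (+ 0) :- c :* con (+ 0) := con (+ 0)) refl _)

      pair-last : ∀ i → suc (suc i) ≡ n → pair n i ≈ - (q ^ 3 * (q ^ i * q ^ i))
      pair-last i ≡.refl = trans
        (+-cong (central-middle i (ℕₚ.n<1+n (suc i))) (-‿cong (*-congˡ (qbinom-diagonal (n ℕ.+ n)))))
        (solve 1 (λ c → con (+ 0) :- c :* con (+ 1) := :- c) refl _)

      pair-beyond : ∀ i → suc i ≡ n → pair n i ≈ 1#
      pair-beyond i ≡.refl = trans
        (+-cong (qbinom-diagonal (n ℕ.+ n)) (-‿cong (*-congˡ (central-above (ℕₚ.n<1+n n)))))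
        (solve 1 (λ c → con (+ 1) :- c :* con (+ 0) := con (+ 1)) refl _)

      pair-above : ∀ i → i ≡ n → pair n i ≈ 0#
      pair-above i ≡.refl = trans
        (+-cong (central-above (ℕₚ.n<1+n n)) (-‿cong (*-congˡ (central-above (ℕₚ.m<n⇒m<1+n (ℕₚ.n<1+n n))))))
        (solve 1 (λ c → con (+ 0) :- c :* con (+ 0) := con (+ 0)) refl _)

    centralSum : ℕ → Carrier
    centralSum d = ∑ n (λ k → q ^ k * central k d)

    -- For k < m the pair at 3k + d has both indices strictly between n and 2n, since 3k + d + 3 ≤
    -- 3m + d ≤ n; only the pair reaching 2n can contribute.
    centralSum-last : ∀ d m → m ℕ.* 3 ℕ.+ d ℕ.≤ n → n ℕ.≤ suc m ℕ.* 3 ℕ.+ d →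
      centralSum d ≈ weightedPair d n m
    centralSum-last d m i≤n n≤i+3 =
      trans (∑-central d (suc m) n n≤i+3) (∑-last m (weightedPair d n) (λ k k<m →
        trans (*-congˡ (trans (*-congˡ (pair-middle (k ℕ.* 3 ℕ.+ d)
                 (ℕₚ.≤-trans (ℕₚ.+-monoˡ-≤ d (ℕₚ.*-monoˡ-≤ 3 k<m)) i≤n))) (zeroʳ _))) (zeroʳ _)))

    private
      e : ℕ → ℕ → ℕ
      e d m = 6 ℕ.* (m ℕ.* m) ℕ.+ 4 ℕ.* (d ℕ.* m)

    -- In centralSum-+r the last pair, of index i, satisfies i + r = n.
    centralSum-+1 : ∀ d m → suc (m ℕ.* 3 ℕ.+ d) ≡ n →
      centralSum d ≈ q ^ (e d m ℕ.+ (m ℕ.* 3 ℕ.+ d))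
    centralSum-+1 d m eq =
      trans (centralSum-last d m (ℕₚ.≤-trans (ℕₚ.n≤1+n _) (ℕₚ.≤-reflexive eq))
                                 (ℕₚ.≤-trans (ℕₚ.≤-reflexive (≡.sym eq)) (ℕₚ.m≤n+m _ 2)))
      (trans (*-congˡ (trans (*-congˡ (pair-beyond i eq)) (*-identityʳ _))) (sym (^-homo-* q (e d m) i)))
      where
      i = m ℕ.* 3 ℕ.+ d

    centralSum-+2 : ∀ d m → let i = m ℕ.* 3 ℕ.+ d in suc (suc i) ≡ n →
      centralSum d ≈ - q ^ (e d m ℕ.+ (i ℕ.+ (3 ℕ.+ (i ℕ.+ i))))
    centralSum-+2 d m eq = begin
      centralSum d
        ≈⟨ centralSum-last d m (ℕₚ.≤-trans (ℕₚ.m≤n+m _ 2) (ℕₚ.≤-reflexive eq))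
                               (ℕₚ.≤-trans (ℕₚ.≤-reflexive (≡.sym eq)) (ℕₚ.n≤1+n _)) ⟩
      weight d m * (q ^ i * pair n i)
        ≈⟨ *-congˡ (*-congˡ (pair-last i eq)) ⟩
      weight d m * (q ^ i * - (q ^ 3 * (q ^ i * q ^ i)))
        ≈⟨ solve 3 (λ w z c → w :* (z :* :- c) := :- (w :* (z :* c))) refl _ _ _ ⟩
      - (weight d m * (q ^ i * (q ^ 3 * (q ^ i * q ^ i))))
        ≈⟨ -‿cong (*-congˡ (*-congˡ (*-congˡ (^-homo-* q i i)))) ⟨
      - (weight d m * (q ^ i * (q ^ 3 * q ^ (i ℕ.+ i))))
        ≈⟨ -‿cong (*-congˡ (*-congˡ (^-homo-* q 3 (i ℕ.+ i)))) ⟨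
      - (weight d m * (q ^ i * q ^ (3 ℕ.+ (i ℕ.+ i))))
        ≈⟨ -‿cong (*-congˡ (^-homo-* q i (3 ℕ.+ (i ℕ.+ i)))) ⟨
      - (weight d m * q ^ (i ℕ.+ (3 ℕ.+ (i ℕ.+ i))))
        ≈⟨ -‿cong (^-homo-* q (e d m) (i ℕ.+ (3 ℕ.+ (i ℕ.+ i)))) ⟨
      - q ^ (e d m ℕ.+ (i ℕ.+ (3 ℕ.+ (i ℕ.+ i)))) ∎
      where
      open Relation.Binary.Reasoning.Setoid setoid
      i = m ℕ.* 3 ℕ.+ d

    centralSum-+3 : ∀ d m → suc (suc (suc (m ℕ.* 3 ℕ.+ d))) ≡ n → centralSum d ≈ 0#
    centralSum-+3 d m eq =
      trans (centralSum-last d m (ℕₚ.≤-trans (ℕₚ.m≤n+m _ 3) (ℕₚ.≤-reflexive eq)) (ℕₚ.≤-reflexive (≡.sym eq)))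
      (trans (*-congˡ (trans (*-congˡ (pair-middle _ (ℕₚ.≤-reflexive eq))) (zeroʳ _))) (zeroʳ _))

    centralSum-+0 : ∀ d m → m ℕ.* 3 ℕ.+ d ≡ n → centralSum d ≈ 0#
    centralSum-+0 d m eq =
      trans (centralSum-last d m (ℕₚ.≤-reflexive eq)
              (ℕₚ.≤-trans (ℕₚ.≤-reflexive (≡.sym eq)) (ℕₚ.m≤n+m _ 3)))
      (trans (*-congˡ (trans (*-congˡ (pair-above _ eq)) (zeroʳ _))) (zeroʳ _))

    catalanValue : Carrier
    catalanValue = centralSum 0 - q * centralSum 1

    ∑-catalan : ∑ n (λ k → q ^ k * (central k 0 - q * central k 1)) ≈ catalanValue
    ∑-catalan = go n
      where
      go : ∀ n → ∑ n (λ k → q ^ k * (central k 0 - q * central k 1)) ≈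
                 ∑ n (λ k → q ^ k * central k 0) - q * ∑ n (λ k → q ^ k * central k 1)
      go zero    = solve 1 (λ q → con (+ 0) := con (+ 0) :- q :* con (+ 0)) refl q
      go (suc n) = begin
        ∑ (suc n) (λ k → q ^ k * (central k 0 - q * central k 1))
          ≈⟨ ∑-suc n (λ k → q ^ k * (central k 0 - q * central k 1)) ⟩
        ∑ n (λ k → q ^ k * (central k 0 - q * central k 1)) + t * (c₀ - q * c₁)
          ≈⟨ +-congʳ (go n) ⟩
        (s₀ - q * s₁) + t * (c₀ - q * c₁)
          ≈⟨ solve 6 (λ s₀ q s₁ t c₀ c₁ → (s₀ :- q :* s₁) :+ t :* (c₀ :- q :* c₁)
                                      := (s₀ :+ t :* c₀) :- q :* (s₁ :+ t :* c₁)) refl s₀ q s₁ t c₀ c₁ ⟩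
        (s₀ + t * c₀) - q * (s₁ + t * c₁)
          ≈⟨ +-cong (∑-suc n (λ k → q ^ k * central k 0)) (-‿cong (*-congˡ (∑-suc n (λ k → q ^ k * central k 1)))) ⟨
        ∑ (suc n) (λ k → q ^ k * central k 0) - q * ∑ (suc n) (λ k → q ^ k * central k 1) ∎
        where
        open Relation.Binary.Reasoning.Setoid setoid
        t  = q ^ n
        c₀ = central n 0
        c₁ = central n 1
        s₀ = ∑ n (λ k → q ^ k * central k 0)
        s₁ = ∑ n (λ k → q ^ k * central k 1)

    -- For d = 1 the index 2n falls on the coefficient 0 of the period; d = 0 gives the exponent 6m²
    -- + 3m = m + n (2m).
    catalanValue-1 : ∀ m → suc (m ℕ.* 3) ≡ n → catalanValue ≈ q ^ m
    catalanValue-1 m eq = begin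
      centralSum 0 - q * centralSum 1
        ≈⟨ +-cong (centralSum-+1 0 m (≡.trans (≡.cong suc (ℕₚ.+-identityʳ _)) eq))
                  -- When n ≡ d modulo 3 both r = 0 and r = 3 are available; r = 0 keeps the same m
                  -- and also covers n = 1, where m = 0.
                  (-‿cong (*-congˡ (centralSum-+0 1 m (≡.trans (ℕₚ.+-comm _ 1) eq)))) ⟩
      q ^ (e 0 m ℕ.+ (m ℕ.* 3 ℕ.+ 0)) - q * 0#
        ≡⟨ ≡.cong (λ a → q ^ a - q * 0#) (≡.trans (exponent m) (≡.cong (λ n → m ℕ.+ n ℕ.* (2 ℕ.* m)) eq)) ⟩
      q ^ (m ℕ.+ n ℕ.* (2 ℕ.* m)) - q * 0#
        ≈⟨ +-congʳ (q^-periodic m (2 ℕ.* m)) ⟩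
      q ^ m - q * 0#
        ≈⟨ solve 2 (λ q x → x :- q :* con (+ 0) := x) refl q (q ^ m) ⟩
      q ^ m ∎
      where
      open Relation.Binary.Reasoning.Setoid setoid
      exponent : ∀ m → 6 ℕ.* (m ℕ.* m) ℕ.+ 4 ℕ.* (0 ℕ.* m) ℕ.+ (m ℕ.* 3 ℕ.+ 0) ≡ m ℕ.+ (suc (m ℕ.* 3)) ℕ.* (2 ℕ.* m)
      exponent = ℕSolver.solve-∀

    -- Here both sums survive, which is why this residue has two terms. The exponents are 2m+1 + n
    -- (2m+1) for d = 0, with sign -, and n (2m+1) for q times the sum with d = 1.
    catalanValue-2 : ∀ m → suc (suc (m ℕ.* 3)) ≡ n → catalanValue ≈ - 1# - q ^ suc (2 ℕ.* m)
    catalanValue-2 m eq = begin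
      centralSum 0 - q * centralSum 1
        ≈⟨ +-cong (centralSum-+2 0 m (≡.trans (≡.cong (λ i → suc (suc i)) (ℕₚ.+-identityʳ _)) eq))
                  (-‿cong (*-congˡ (centralSum-+1 1 m (≡.trans (≡.cong suc (ℕₚ.+-comm _ 1)) eq)))) ⟩
      - q ^ (e 0 m ℕ.+ ((m ℕ.* 3 ℕ.+ 0) ℕ.+ (3 ℕ.+ ((m ℕ.* 3 ℕ.+ 0) ℕ.+ (m ℕ.* 3 ℕ.+ 0)))))
        - q ^ suc (e 1 m ℕ.+ (m ℕ.* 3 ℕ.+ 1))
        ≡⟨ ≡.cong₂ (λ a b → - q ^ a - q ^ b)
             (≡.trans (exponent₀ m) (≡.cong (λ n → suc (2 ℕ.* m) ℕ.+ n ℕ.* suc (2 ℕ.* m)) eq))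
             (≡.trans (exponent₁ m) (≡.cong (λ n → 0 ℕ.+ n ℕ.* suc (2 ℕ.* m)) eq)) ⟩
      - q ^ (suc (2 ℕ.* m) ℕ.+ n ℕ.* suc (2 ℕ.* m)) - q ^ (0 ℕ.+ n ℕ.* suc (2 ℕ.* m))
        ≈⟨ +-cong (-‿cong (q^-periodic (suc (2 ℕ.* m)) (suc (2 ℕ.* m)))) (-‿cong (q^-periodic 0 (suc (2 ℕ.* m)))) ⟩
      - q ^ suc (2 ℕ.* m) - 1#
        ≈⟨ +-comm _ _ ⟩
      - 1# - q ^ suc (2 ℕ.* m) ∎
      where
      open Relation.Binary.Reasoning.Setoid setoid
      exponent₀ : ∀ m → 6 ℕ.* (m ℕ.* m) ℕ.+ 4 ℕ.* (0 ℕ.* m) ℕ.+ ((m ℕ.* 3 ℕ.+ 0) ℕ.+ (3 ℕ.+ ((m ℕ.* 3 ℕ.+ 0) ℕ.+ (m ℕ.* 3 ℕ.+ 0))))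
                      ≡ suc (2 ℕ.* m) ℕ.+ suc (suc (m ℕ.* 3)) ℕ.* suc (2 ℕ.* m)
      exponent₀ = ℕSolver.solve-∀
      exponent₁ : ∀ m → suc (6 ℕ.* (m ℕ.* m) ℕ.+ 4 ℕ.* (1 ℕ.* m) ℕ.+ (m ℕ.* 3 ℕ.+ 1)) ≡ suc (suc (m ℕ.* 3)) ℕ.* suc (2 ℕ.* m)
      exponent₁ = ℕSolver.solve-∀

    -- Now d = 0 meets the coefficient 0. The -1 of the period for d = 1 cancels the sign in - q
    -- S_1, leaving the exponent m+1 + n (2m+2).
    catalanValue-3 : ∀ m → suc m ℕ.* 3 ≡ n → catalanValue ≈ q ^ suc m
    catalanValue-3 m eq = begin
      centralSum 0 - q * centralSum 1
        ≈⟨ +-cong (centralSum-+3 0 m (≡.trans (≡.cong (3 ℕ.+_) (ℕₚ.+-identityʳ _)) eq))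
                  (-‿cong (*-congˡ (centralSum-+2 1 m (≡.trans (≡.cong (2 ℕ.+_) (ℕₚ.+-comm _ 1)) eq)))) ⟩
      0# - q * - q ^ (e 1 m ℕ.+ (i ℕ.+ (3 ℕ.+ (i ℕ.+ i))))
        ≈⟨ solve 2 (λ q x → con (+ 0) :- q :* :- x := q :* x) refl q _ ⟩
      q ^ suc (e 1 m ℕ.+ (i ℕ.+ (3 ℕ.+ (i ℕ.+ i))))
        ≡⟨ ≡.cong (q ^_) (≡.trans (exponent m) (≡.cong (λ n → suc m ℕ.+ n ℕ.* (2 ℕ.* suc m)) eq)) ⟩
      q ^ (suc m ℕ.+ n ℕ.* (2 ℕ.* suc m))
        ≈⟨ q^-periodic (suc m) (2 ℕ.* suc m) ⟩
      q ^ suc m ∎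
      where
      open Relation.Binary.Reasoning.Setoid setoid
      i = m ℕ.* 3 ℕ.+ 1
      exponent : ∀ m → let i = m ℕ.* 3 ℕ.+ 1 in
        suc (6 ℕ.* (m ℕ.* m) ℕ.+ 4 ℕ.* (1 ℕ.* m) ℕ.+ (i ℕ.+ (3 ℕ.+ (i ℕ.+ i)))) ≡ suc m ℕ.+ suc m ℕ.* 3 ℕ.* (2 ℕ.* suc m)
      exponent = ℕSolver.solve-∀

-- Polynomials

module PolynomialRing {c ℓ} (R : CommutativeRing c ℓ) where
  open CommutativeRing R hiding (zero)
  open Polynomial rawRing
  open Algebra.Properties.Ring ring
  open IntegerImage R using (module Solver)
  open Solver using (solve; _:=_; _:+_; _:*_)

  scale : Carrier → Poly → Poly
  scale a = List.map (a *_)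

  coeff-+ : ∀ p r i → coeff (p +ₚ r) i ≈ coeff p i + coeff r i
  coeff-+ []      r       i       = sym (+-identityˡ _)
  coeff-+ (a ∷ p) []      i       = sym (+-identityʳ _)
  coeff-+ (a ∷ p) (b ∷ r) zero    = refl
  coeff-+ (a ∷ p) (b ∷ r) (suc i) = coeff-+ p r i

  coeff-neg : ∀ p i → coeff (-ₚ p) i ≈ - coeff p i
  coeff-neg []      i       = sym -0#≈0#
  coeff-neg (a ∷ p) zero    = refl
  coeff-neg (a ∷ p) (suc i) = coeff-neg p i

  coeff-scale : ∀ a p i → coeff (scale a p) i ≈ a * coeff p i
  coeff-scale a []      i       = sym (zeroʳ a)
  coeff-scale a (b ∷ p) zero    = refl
  coeff-scale a (b ∷ p) (suc i) = coeff-scale a p i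

  ∷*-zero : ∀ a p r → coeff ((a ∷ p) *ₚ r) 0 ≈ a * coeff r 0
  ∷*-zero a p r =
    trans (coeff-+ (scale a r) (0# ∷ p *ₚ r) 0) (trans (+-identityʳ _) (coeff-scale a r 0))

  ∷*-suc : ∀ a p r i → coeff ((a ∷ p) *ₚ r) (suc i) ≈ a * coeff r (suc i) + coeff (p *ₚ r) i
  ∷*-suc a p r i =
    trans (coeff-+ (scale a r) (0# ∷ p *ₚ r) (suc i)) (+-congʳ (coeff-scale a r (suc i)))

  *-∷-zero : ∀ p b r → coeff (p *ₚ (b ∷ r)) 0 ≈ coeff p 0 * b
  *-∷-zero []      b r = sym (zeroˡ b)
  *-∷-zero (a ∷ p) b r = ∷*-zero a p (b ∷ r)

  -- The product recurses on its left factor. This mirrored recursion on the right factor gives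
  -- commutativity, and through it congruence in the left factor.
  *-∷-suc : ∀ p b r i → coeff (p *ₚ (b ∷ r)) (suc i) ≈ coeff p (suc i) * b + coeff (p *ₚ r) i
  *-∷-suc []      b r i       = sym (trans (+-identityʳ _) (zeroˡ b))
  *-∷-suc (a ∷ p) b r zero    =
    trans (∷*-suc a p (b ∷ r) 0) (trans (+-comm _ _) (+-cong (*-∷-zero p b r) (sym (∷*-zero a p r))))
  *-∷-suc (a ∷ p) b r (suc i) = begin
    coeff ((a ∷ p) *ₚ (b ∷ r)) (suc (suc i))           ≈⟨ ∷*-suc a p (b ∷ r) (suc i) ⟩
    x + coeff (p *ₚ (b ∷ r)) (suc i)                   ≈⟨ +-congˡ (*-∷-suc p b r i) ⟩
    x + (y + z)                                        ≈⟨ solve 3 (λ x y z → x :+ (y :+ z) := y :+ (x :+ z)) refl x y z ⟩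
    y + (x + z)                                        ≈⟨ +-congˡ (∷*-suc a p r i) ⟨
    y + coeff ((a ∷ p) *ₚ r) (suc i)                   ∎
    where
    open Relation.Binary.Reasoning.Setoid setoid
    x = a * coeff r (suc i)
    y = coeff p (suc i) * b
    z = coeff (p *ₚ r) i

  *ₚ-zeroʳ : ∀ p → (p *ₚ []) ≈ₚ []
  *ₚ-zeroʳ []      i       = refl
  *ₚ-zeroʳ (a ∷ p) zero    = refl
  *ₚ-zeroʳ (a ∷ p) (suc i) = *ₚ-zeroʳ p i

  *ₚ-comm : ∀ p r → (p *ₚ r) ≈ₚ (r *ₚ p)
  *ₚ-comm []      r i       = sym (*ₚ-zeroʳ r i)
  *ₚ-comm (a ∷ p) r zero    = trans (∷*-zero a p r) (trans (*-comm _ _) (sym (*-∷-zero r a p)))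
  *ₚ-comm (a ∷ p) r (suc i) =
    trans (∷*-suc a p r i) (trans (+-cong (*-comm _ _) (*ₚ-comm p r i)) (sym (*-∷-suc r a p i)))

  *ₚ-congˡ : ∀ p {r s} → r ≈ₚ s → (p *ₚ r) ≈ₚ (p *ₚ s)
  *ₚ-congˡ []      e i       = refl
  *ₚ-congˡ (a ∷ p) {r} {s} e zero    =
    trans (∷*-zero a p r) (trans (*-congˡ (e 0)) (sym (∷*-zero a p s)))
  *ₚ-congˡ (a ∷ p) {r} {s} e (suc i) =
    trans (∷*-suc a p r i) (trans (+-cong (*-congˡ (e (suc i))) (*ₚ-congˡ p e i)) (sym (∷*-suc a p s i)))

  *ₚ-cong : ∀ {p p′ r r′} → p ≈ₚ p′ → r ≈ₚ r′ → (p *ₚ r) ≈ₚ (p′ *ₚ r′)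
  *ₚ-cong {p} {p′} {r} {r′} e f i =
    trans (*ₚ-congˡ p f i) (trans (*ₚ-comm p r′ i) (trans (*ₚ-congˡ r′ e i) (*ₚ-comm r′ p′ i)))

  *ₚ-distribˡ : ∀ p r s → (p *ₚ (r +ₚ s)) ≈ₚ ((p *ₚ r) +ₚ (p *ₚ s))
  *ₚ-distribˡ []      r s i       = refl
  *ₚ-distribˡ (a ∷ p) r s zero    = begin
    coeff ((a ∷ p) *ₚ (r +ₚ s)) 0                    ≈⟨ ∷*-zero a p (r +ₚ s) ⟩
    a * coeff (r +ₚ s) 0                             ≈⟨ *-congˡ (coeff-+ r s 0) ⟩
    a * (coeff r 0 + coeff s 0)                      ≈⟨ distribˡ _ _ _ ⟩
    a * coeff r 0 + a * coeff s 0                    ≈⟨ +-cong (∷*-zero a p r) (∷*-zero a p s) ⟨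
    coeff ((a ∷ p) *ₚ r) 0 + coeff ((a ∷ p) *ₚ s) 0  ≈⟨ coeff-+ ((a ∷ p) *ₚ r) ((a ∷ p) *ₚ s) 0 ⟨
    coeff (((a ∷ p) *ₚ r) +ₚ ((a ∷ p) *ₚ s)) 0       ∎
    where open Relation.Binary.Reasoning.Setoid setoid
  *ₚ-distribˡ (a ∷ p) r s (suc i) = begin
    coeff ((a ∷ p) *ₚ (r +ₚ s)) (suc i)
      ≈⟨ ∷*-suc a p (r +ₚ s) i ⟩
    a * coeff (r +ₚ s) (suc i) + coeff (p *ₚ (r +ₚ s)) i
      ≈⟨ +-cong (*-congˡ (coeff-+ r s (suc i))) (trans (*ₚ-distribˡ p r s i) (coeff-+ (p *ₚ r) (p *ₚ s) i)) ⟩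
    a * (coeff r (suc i) + coeff s (suc i)) + (coeff (p *ₚ r) i + coeff (p *ₚ s) i)
      ≈⟨ solve 5 (λ a r s x y → a :* (r :+ s) :+ (x :+ y) := (a :* r :+ x) :+ (a :* s :+ y)) refl _ _ _ _ _ ⟩
    (a * coeff r (suc i) + coeff (p *ₚ r) i) + (a * coeff s (suc i) + coeff (p *ₚ s) i)
      ≈⟨ +-cong (∷*-suc a p r i) (∷*-suc a p s i) ⟨
    coeff ((a ∷ p) *ₚ r) (suc i) + coeff ((a ∷ p) *ₚ s) (suc i)
      ≈⟨ coeff-+ ((a ∷ p) *ₚ r) ((a ∷ p) *ₚ s) (suc i) ⟨
    coeff (((a ∷ p) *ₚ r) +ₚ ((a ∷ p) *ₚ s)) (suc i) ∎
    where open Relation.Binary.Reasoning.Setoid setoid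

  *ₚ-distribʳ : ∀ p r s → ((r +ₚ s) *ₚ p) ≈ₚ ((r *ₚ p) +ₚ (s *ₚ p))
  *ₚ-distribʳ p r s i = begin
    coeff ((r +ₚ s) *ₚ p) i                ≈⟨ *ₚ-comm (r +ₚ s) p i ⟩
    coeff (p *ₚ (r +ₚ s)) i                ≈⟨ *ₚ-distribˡ p r s i ⟩
    coeff ((p *ₚ r) +ₚ (p *ₚ s)) i         ≈⟨ coeff-+ (p *ₚ r) (p *ₚ s) i ⟩
    coeff (p *ₚ r) i + coeff (p *ₚ s) i    ≈⟨ +-cong (*ₚ-comm p r i) (*ₚ-comm p s i) ⟩
    coeff (r *ₚ p) i + coeff (s *ₚ p) i    ≈⟨ coeff-+ (r *ₚ p) (s *ₚ p) i ⟨
    coeff ((r *ₚ p) +ₚ (s *ₚ p)) i         ∎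
    where open Relation.Binary.Reasoning.Setoid setoid

  scale-*ₚ : ∀ a p r → (scale a p *ₚ r) ≈ₚ scale a (p *ₚ r)
  scale-*ₚ a []      r i       = refl
  scale-*ₚ a (b ∷ p) r zero    = begin
    coeff (scale a (b ∷ p) *ₚ r) 0       ≈⟨ ∷*-zero (a * b) (scale a p) r ⟩
    a * b * coeff r 0                    ≈⟨ *-assoc _ _ _ ⟩
    a * (b * coeff r 0)                  ≈⟨ *-congˡ (∷*-zero b p r) ⟨
    a * coeff ((b ∷ p) *ₚ r) 0           ≈⟨ coeff-scale a ((b ∷ p) *ₚ r) 0 ⟨
    coeff (scale a ((b ∷ p) *ₚ r)) 0     ∎
    where open Relation.Binary.Reasoning.Setoid setoid
  scale-*ₚ a (b ∷ p) r (suc i) = begin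
    coeff (scale a (b ∷ p) *ₚ r) (suc i)                   ≈⟨ ∷*-suc (a * b) (scale a p) r i ⟩
    a * b * coeff r (suc i) + coeff (scale a p *ₚ r) i     ≈⟨ +-cong (*-assoc _ _ _) (trans (scale-*ₚ a p r i) (coeff-scale a (p *ₚ r) i)) ⟩
    a * (b * coeff r (suc i)) + a * coeff (p *ₚ r) i       ≈⟨ distribˡ _ _ _ ⟨
    a * (b * coeff r (suc i) + coeff (p *ₚ r) i)           ≈⟨ *-congˡ (∷*-suc b p r i) ⟨
    a * coeff ((b ∷ p) *ₚ r) (suc i)                       ≈⟨ coeff-scale a ((b ∷ p) *ₚ r) (suc i) ⟨
    coeff (scale a ((b ∷ p) *ₚ r)) (suc i)                 ∎
    where open Relation.Binary.Reasoning.Setoid setoid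

  shift-*ₚ : ∀ p r → ((0# ∷ p) *ₚ r) ≈ₚ (0# ∷ (p *ₚ r))
  shift-*ₚ p r zero    = trans (∷*-zero 0# p r) (zeroˡ _)
  shift-*ₚ p r (suc i) = trans (∷*-suc 0# p r i) (trans (+-congʳ (zeroˡ _)) (+-identityˡ _))

  *ₚ-assoc : ∀ p r s → ((p *ₚ r) *ₚ s) ≈ₚ (p *ₚ (r *ₚ s))
  *ₚ-assoc []      r s i = refl
  *ₚ-assoc (a ∷ p) r s i = begin
    coeff ((scale a r +ₚ (0# ∷ (p *ₚ r))) *ₚ s) i
      ≈⟨ *ₚ-distribʳ s (scale a r) (0# ∷ (p *ₚ r)) i ⟩
    coeff ((scale a r *ₚ s) +ₚ ((0# ∷ (p *ₚ r)) *ₚ s)) i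
      ≈⟨ coeff-+ (scale a r *ₚ s) ((0# ∷ (p *ₚ r)) *ₚ s) i ⟩
    coeff (scale a r *ₚ s) i + coeff ((0# ∷ (p *ₚ r)) *ₚ s) i
      ≈⟨ +-cong (scale-*ₚ a r s i) (trans (shift-*ₚ (p *ₚ r) s i) (shift i)) ⟩
    coeff (scale a (r *ₚ s)) i + coeff (0# ∷ (p *ₚ (r *ₚ s))) i
      ≈⟨ coeff-+ (scale a (r *ₚ s)) (0# ∷ (p *ₚ (r *ₚ s))) i ⟨
    coeff (scale a (r *ₚ s) +ₚ (0# ∷ (p *ₚ (r *ₚ s)))) i ∎
    where
    open Relation.Binary.Reasoning.Setoid setoid
    shift : (0# ∷ ((p *ₚ r) *ₚ s)) ≈ₚ (0# ∷ (p *ₚ (r *ₚ s)))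
    shift zero    = refl
    shift (suc i) = *ₚ-assoc p r s i

  const-*ₚ : ∀ a p i → coeff (const a *ₚ p) i ≈ a * coeff p i
  const-*ₚ a p zero    = ∷*-zero a [] p
  const-*ₚ a p (suc i) = trans (∷*-suc a [] p i) (+-identityʳ _)

  polynomialRing : CommutativeRing c ℓ
  polynomialRing = record
    { Carrier = Poly ; _≈_ = _≈ₚ_ ; _+_ = _+ₚ_ ; _*_ = _*ₚ_ ; -_ = -ₚ_ ; 0# = [] ; 1# = const 1#
    ; isCommutativeRing = record
      { isRing = record
        { +-isAbelianGroup = record
          { isGroup = record
            { isMonoid = record
              { isSemigroup = record
                { isMagma = record
                  { isEquivalence = record
                    { refl = λ i → refl ; sym = λ e i → sym (e i) ; trans = λ e f i → trans (e i) (f i) }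
                  ; ∙-cong = λ {p} {p′} {r} {r′} e f i →
                      trans (coeff-+ p r i) (trans (+-cong (e i) (f i)) (sym (coeff-+ p′ r′ i))) }
                ; assoc = λ p r s i →
                    trans (trans (coeff-+ (p +ₚ r) s i) (+-congʳ (coeff-+ p r i)))
                      (trans (+-assoc _ _ _) (sym (trans (coeff-+ p (r +ₚ s) i) (+-congˡ (coeff-+ r s i))))) }
              ; identity = (λ p i → refl) , (λ p i → trans (coeff-+ p [] i) (+-identityʳ _)) }
            ; inverse = (λ p i → trans (coeff-+ (-ₚ p) p i) (trans (+-congʳ (coeff-neg p i)) (-‿inverseˡ _)))
                      , (λ p i → trans (coeff-+ p (-ₚ p) i) (trans (+-congˡ (coeff-neg p i)) (-‿inverseʳ _)))
            ; ⁻¹-cong = λ {p} {r} e i → trans (coeff-neg p i) (trans (-‿cong (e i)) (sym (coeff-neg r i))) }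
          ; comm = λ p r i → trans (coeff-+ p r i) (trans (+-comm _ _) (sym (coeff-+ r p i))) }
        ; *-cong = λ {p} {p′} {r} {r′} → *ₚ-cong {p} {p′} {r} {r′}
        ; *-assoc = *ₚ-assoc
        ; *-identity = (λ p i → trans (const-*ₚ 1# p i) (*-identityˡ _))
                     , (λ p i → trans (*ₚ-comm p (const 1#) i) (trans (const-*ₚ 1# p i) (*-identityˡ _)))
        ; distrib = *ₚ-distribˡ , *ₚ-distribʳ }
      ; *-comm = *ₚ-comm } }

-- Ring homomorphisms and evaluation of polynomials

IsHomomorphism : ∀ {a b c d} (R : CommutativeRing a b) (S : CommutativeRing c d) →
  (CommutativeRing.Carrier R → CommutativeRing.Carrier S) → Set _
IsHomomorphism R S = IsRingHomomorphism
  where open RingMorphisms (CommutativeRing.rawRing R) (CommutativeRing.rawRing S)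

module _ {a b c d} {R : CommutativeRing a b} {S : CommutativeRing c d} where
  private
    module R = CommutativeRing R
    module S = CommutativeRing S

  mkIsHomomorphism : {φ : R.Carrier → S.Carrier} → (∀ {x y} → x R.≈ y → φ x S.≈ φ y) →
    (∀ x y → φ (x R.+ y) S.≈ φ x S.+ φ y) → (∀ x y → φ (x R.* y) S.≈ φ x S.* φ y) →
    (∀ x → φ (R.- x) S.≈ S.- φ x) → φ R.0# S.≈ S.0# → φ R.1# S.≈ S.1# → IsHomomorphism R S φ
  mkIsHomomorphism cong +-homo *-homo -‿homo 0-homo 1-homo = record
    { isSemiringHomomorphism = record
      { isNearSemiringHomomorphism = record
        { +-isMonoidHomomorphism = record
          { isMagmaHomomorphism = record { isRelHomomorphism = record { cong = cong } ; homo = +-homo }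
          ; ε-homo = 0-homo }
        ; *-homo = *-homo }
      ; 1#-homo = 1-homo }
    ; -‿homo = -‿homo }

module Homomorphism {a b c d} {R : CommutativeRing a b} {S : CommutativeRing c d}
  {φ : CommutativeRing.Carrier R → CommutativeRing.Carrier S} (isHom : IsHomomorphism R S φ) where
  private
    module R where
      open CommutativeRing R public
      open RingLemmas R public using (∑)
      open Algebra.Properties.Semiring.Exp semiring public using (_^_)
      open QBinomial R public using (qbinom)
    module S where
      open RingLemmas S public using (∑)
      open QBinomial S public using (qbinom)
  open CommutativeRing S hiding (zero)
  open Algebra.Properties.Semiring.Exp semiring
  open RingMorphisms (CommutativeRing.rawRing R) rawRing
  open IsRingHomomorphism isHom public

  ^-homo : ∀ x n → φ (x R.^ n) ≈ φ x ^ n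
  ^-homo x zero    = 1#-homo
  ^-homo x (suc n) = trans (*-homo x (x R.^ n)) (*-congˡ (^-homo x n))

  ∑-homo : ∀ n f → φ (R.∑ n f) ≈ S.∑ n (λ k → φ (f k))
  ∑-homo zero    f = 0#-homo
  ∑-homo (suc n) f = trans (+-homo (f 0) (R.∑ n (λ k → f (suc k)))) (+-congˡ (∑-homo n (λ k → f (suc k))))

  qbinom-homo : ∀ x n k → φ (R.qbinom x n k) ≈ S.qbinom (φ x) n k
  qbinom-homo x n       zero    = 1#-homo
  qbinom-homo x zero    (suc k) = 0#-homo
  qbinom-homo x (suc n) (suc k) = trans (+-homo _ _) (+-cong (qbinom-homo x n k)
    (trans (*-homo _ _) (*-cong (^-homo x (suc k)) (qbinom-homo x n (suc k)))))

module Evaluation {a b c d} {R : CommutativeRing a b} {S : CommutativeRing c d}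
  {φ : CommutativeRing.Carrier R → CommutativeRing.Carrier S} (isHom : IsHomomorphism R S φ)
  (x : CommutativeRing.Carrier S) where
  private
    module R = CommutativeRing R
    module φ = Homomorphism {R = R} {S} isHom
  open CommutativeRing S hiding (zero)
  open Algebra.Properties.Ring ring
  open Polynomial R.rawRing
  open PolynomialRing R
  open IntegerImage S using (module Solver)
  open Solver using (solve; _:=_; _:+_; _:*_; :-_; con)
  open Relation.Binary.Reasoning.Setoid setoid

  eval : Poly → Carrier
  eval []      = 0#
  eval (a ∷ p) = φ a + x * eval p

  0+x0 : ∀ {u v} → u ≈ 0# → v ≈ 0# → u + x * v ≈ 0#
  0+x0 u≈0 v≈0 = trans (+-cong u≈0 (trans (*-congˡ v≈0) (zeroʳ x))) (+-identityʳ 0#)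

  -- Equal polynomials may be lists of different lengths; this treats the surplus zeros in
  -- `eval-cong`.
  eval-zero : ∀ p → p ≈ₚ [] → eval p ≈ 0#
  eval-zero []      _ = refl
  eval-zero (a ∷ p) e = 0+x0 (trans (φ.⟦⟧-cong (e 0)) φ.0#-homo) (eval-zero p (λ i → e (suc i)))

  eval-cong : ∀ p r → p ≈ₚ r → eval p ≈ eval r
  eval-cong []      r       e = sym (eval-zero r (λ i → R.sym (e i)))
  eval-cong (a ∷ p) []      e = eval-zero (a ∷ p) e
  eval-cong (a ∷ p) (b ∷ r) e = +-cong (φ.⟦⟧-cong (e 0)) (*-congˡ (eval-cong p r (λ i → e (suc i))))

  eval-+ : ∀ p r → eval (p +ₚ r) ≈ eval p + eval r
  eval-+ []      r       = sym (+-identityˡ _)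
  eval-+ (a ∷ p) []      = sym (+-identityʳ _)
  eval-+ (a ∷ p) (b ∷ r) = trans (+-cong (φ.+-homo a b) (*-congˡ (eval-+ p r)))
    (solve 5 (λ a b x p r → (a :+ b) :+ x :* (p :+ r) := (a :+ x :* p) :+ (b :+ x :* r)) refl _ _ _ _ _)

  eval-neg : ∀ p → eval (-ₚ p) ≈ - eval p
  eval-neg []      = sym -0#≈0#
  eval-neg (a ∷ p) = trans (+-cong (φ.-‿homo a) (*-congˡ (eval-neg p)))
    (solve 3 (λ a x p → :- a :+ x :* :- p := :- (a :+ x :* p)) refl _ _ _)

  eval-scale : ∀ a p → eval (scale a p) ≈ φ a * eval p
  eval-scale a []      = sym (zeroʳ _)
  eval-scale a (b ∷ p) = trans (+-cong (φ.*-homo a b) (*-congˡ (eval-scale a p)))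
    (solve 4 (λ a b x p → a :* b :+ x :* (a :* p) := a :* (b :+ x :* p)) refl _ _ _ _)

  eval-* : ∀ p r → eval (p *ₚ r) ≈ eval p * eval r
  eval-* []      r = sym (zeroˡ _)
  eval-* (a ∷ p) r = begin
    eval (scale a r +ₚ (R.0# ∷ (p *ₚ r)))                 ≈⟨ eval-+ (scale a r) (R.0# ∷ (p *ₚ r)) ⟩
    eval (scale a r) + (φ R.0# + x * eval (p *ₚ r))       ≈⟨ +-cong (eval-scale a r) (+-cong φ.0#-homo (*-congˡ (eval-* p r))) ⟩
    φ a * eval r + (0# + x * (eval p * eval r))           ≈⟨ solve 4 (λ a x p r → a :* r :+ (con (ℤ.+ 0) :+ x :* (p :* r)) := (a :+ x :* p) :* r) refl _ _ _ _ ⟩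
    (φ a + x * eval p) * eval r                           ∎

  eval-const : ∀ a → eval (const a) ≈ φ a
  eval-const a = trans (+-congˡ (zeroʳ x)) (+-identityʳ _)

  eval-X : eval X ≈ x
  eval-X = trans (+-cong φ.0#-homo (trans (*-congˡ (trans (eval-const R.1#) φ.1#-homo)) (*-identityʳ x))) (+-identityˡ x)

  eval-isHomomorphism : IsHomomorphism polynomialRing S eval
  eval-isHomomorphism = mkIsHomomorphism {R = polynomialRing} {S = S}
    (λ {p} {r} → eval-cong p r) eval-+ eval-* eval-neg refl (trans (eval-const R.1#) φ.1#-homo)

-- Roots of polynomials

module Roots {c ℓ} (R : CommutativeRing c ℓ) where
  open CommutativeRing R hiding (zero)
  open Polynomial rawRing
  open PolynomialRing R
  open IntegerImage R using (module Solver)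
  open Solver using (solve; _:=_; _:+_; _:-_; _:*_; :-_; con)
  open Relation.Binary.Reasoning.Setoid setoid

  id-isHomomorphism : IsHomomorphism R R (λ x → x)
  id-isHomomorphism = mkIsHomomorphism {R = R} {S = R}
    (λ e → e) (λ _ _ → refl) (λ _ _ → refl) (λ _ → refl) refl refl

  module At (x : Carrier) = Evaluation {R = R} {S = R} id-isHomomorphism x
  open At using (eval)

  -- A bound rather than a degree: lists may end in zeros, and a general ring offers no test for a
  -- zero coefficient.
  DegreeBelow : ℕ → Poly → Set ℓ
  DegreeBelow n p = ∀ i → n ℕ.≤ i → coeff p i ≈ 0#

  -- p = (X - α) · horner α p + p(α), by Horner's scheme.
  horner : Carrier → Poly → Poly
  horner α []      = []
  horner α (a ∷ p) = eval α p ∷ horner α p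

  eval-horner : ∀ α β p → eval β p ≈ (β - α) * eval β (horner α p) + eval α p
  eval-horner α β []      = sym (trans (+-identityʳ _) (zeroʳ _))
  eval-horner α β (a ∷ p) = trans (+-congˡ (*-congˡ (eval-horner α β p)))
    (solve 5 (λ a α β d p → a :+ β :* ((β :- α) :* d :+ p) := (β :- α) :* (p :+ β :* d) :+ (a :+ α :* p))
       refl a α β (eval β (horner α p)) (eval α p))

  coeff-horner-zero : ∀ α p → coeff p 0 ≈ eval α p - α * coeff (horner α p) 0
  coeff-horner-zero α []      = sym (trans (+-congˡ (-‿cong (zeroʳ α))) (-‿inverseʳ 0#))
  coeff-horner-zero α (a ∷ p) = solve 3 (λ a α p → a := (a :+ α :* p) :- α :* p) refl a α (eval α p)

  coeff-horner-suc : ∀ α p i → coeff p (suc i) ≈ coeff (horner α p) i - α * coeff (horner α p) (suc i)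
  coeff-horner-suc α []      i       = sym (trans (+-congˡ (-‿cong (zeroʳ α))) (-‿inverseʳ 0#))
  coeff-horner-suc α (a ∷ p) zero    = coeff-horner-zero α p
  coeff-horner-suc α (a ∷ p) (suc i) = coeff-horner-suc α p i

  horner-degree : ∀ α n p → DegreeBelow (suc n) p → DegreeBelow n (horner α p)
  horner-degree α n       []      _ i       _         = refl
  horner-degree α zero    (a ∷ p) e zero    _         = At.eval-zero α p (λ i → e (suc i) (s≤s z≤n))
  horner-degree α zero    (a ∷ p) e (suc i) _         = horner-degree α zero p (λ j _ → e (suc j) (s≤s z≤n)) i z≤n
  horner-degree α (suc n) (a ∷ p) e (suc i) (s≤s n≤i) = horner-degree α n p (λ j n<j → e (suc j) (s≤s n<j)) i n≤i

  Regular : Carrier → Set _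
  Regular x = ∀ {y} → x * y ≈ 0# → y ≈ 0#

  -- Divide by X - α. Another root β satisfies (β - α) · quotient(β) = 0, and regularity of β - α
  -- makes it a root of the quotient, which is therefore 0 by induction. Regular differences replace
  -- the assumption of an integral domain.
  vanishing : ∀ αs → AllPairs (λ α β → Regular (β - α)) αs → ∀ p → DegreeBelow (length αs) p →
    All (λ α → eval α p ≈ 0#) αs → p ≈ₚ []
  vanishing []       _          p deg _           = λ i → deg i z≤n
  vanishing (α ∷ αs) (ds ∷ dss) p deg (α0 ∷ αs0) = coeffs
    where
    quotient : horner α p ≈ₚ []
    quotient = vanishing αs dss (horner α p) (horner-degree α _ p deg) (All.zipWith
      (λ { {β} (d , β0) → d (begin
        (β - α) * eval β (horner α p)                  ≈⟨ +-identityʳ _ ⟨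
        (β - α) * eval β (horner α p) + 0#             ≈⟨ +-congˡ α0 ⟨
        (β - α) * eval β (horner α p) + eval α p       ≈⟨ eval-horner α β p ⟨
        eval β p                                      ≈⟨ β0 ⟩
        0#                                            ∎) })
      (ds , αs0))
    0-α0 : ∀ {u v} → u ≈ 0# → v ≈ 0# → u - α * v ≈ 0#
    0-α0 u≈0 v≈0 = trans (+-cong u≈0 (-‿cong (trans (*-congˡ v≈0) (zeroʳ α)))) (-‿inverseʳ 0#)
    coeffs : p ≈ₚ []
    coeffs zero    = trans (coeff-horner-zero α p) (0-α0 α0 (quotient 0))
    coeffs (suc i) = trans (coeff-horner-suc α p i) (0-α0 (quotient i) (quotient (suc i)))

  module _ {t} {T : Set t} (f : T → Carrier) where

    -- Taking the index list and the function f separately makes this unfold to `cyclotomicProduct`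
    -- for f = `ζ ^_`.
    rootProduct : List T → Poly
    rootProduct ts = List.foldr _*ₚ_ (const 1#) (List.map (λ t → X +ₚ -ₚ const (f t)) ts)

    eval-rootProduct : ∀ {t ts} → t ∈ ts → eval (f t) (rootProduct ts) ≈ 0#
    eval-rootProduct {t} {s ∷ ts} t∈ = trans (At.eval-* (f t) (X +ₚ -ₚ const (f s)) (rootProduct ts)) (factor t∈)
      where
      factor : t ∈ s ∷ ts → eval (f t) (X +ₚ -ₚ const (f s)) * eval (f t) (rootProduct ts) ≈ 0#
      factor (here ≡.refl) = trans (*-congʳ
        (solve 1 (λ x → (con (ℤ.+ 0) :+ :- x) :+ x :* (con (ℤ.+ 1) :+ x :* con (ℤ.+ 0)) := con (ℤ.+ 0)) refl (f t))) (zeroˡ _)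
      factor (there t∈ts)  = trans (*-congˡ (eval-rootProduct t∈ts)) (zeroʳ _)

    private
      coeff-factor : ∀ t p i → coeff ((X +ₚ -ₚ const (f t)) *ₚ p) (suc i) ≈ (0# - f t) * coeff p (suc i) + coeff p i
      coeff-factor t p i = trans (∷*-suc (0# - f t) (1# ∷ []) p i)
        (+-congˡ (trans (const-*ₚ 1# p i) (*-identityˡ _)))

    rootProduct-degree : ∀ ts → DegreeBelow (suc (length ts)) (rootProduct ts)
    rootProduct-degree []       (suc i) _         = refl
    rootProduct-degree (t ∷ ts) (suc i) (s≤s n<i) = trans (coeff-factor t (rootProduct ts) i)
      (trans (+-cong (trans (*-congˡ (rootProduct-degree ts (suc i) (ℕₚ.m≤n⇒m≤1+n n<i))) (zeroʳ _))
                     (rootProduct-degree ts i n<i)) (+-identityʳ 0#))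

    rootProduct-monic : ∀ ts → coeff (rootProduct ts) (length ts) ≈ 1#
    rootProduct-monic []       = refl
    rootProduct-monic (t ∷ ts) = trans (coeff-factor t (rootProduct ts) (length ts))
      (trans (+-cong (trans (*-congˡ (rootProduct-degree ts _ ℕₚ.≤-refl)) (zeroʳ _)) (rootProduct-monic ts))
             (+-identityˡ 1#))

-- Polynomial division and series quotients

module Division {c ℓ} (R : CommutativeRing c ℓ) where
  open CommutativeRing R hiding (zero)
  open Polynomial rawRing
  open PolynomialRing R
  open Roots R using (DegreeBelow)
  open IntegerImage R using (module Solver)
  open Solver using (solve; _:=_; _:+_; _:-_)
  open Relation.Binary.Reasoning.Setoid setoid

  -- From p = s d + r follows a + X p = (X s) d + (a + X r). The new remainder has degree at most n,
  -- so subtracting u d, with u its coefficient of X^n, restores the bound.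
  divMod-monic : ∀ n d → coeff d n ≈ 1# → DegreeBelow (suc n) d →
    ∀ p → ∃₂ λ s r → p ≈ₚ (s *ₚ d) +ₚ r × DegreeBelow n r
  divMod-monic n d monic deg []      = [] , [] , (λ _ → refl) , (λ _ _ → refl)
  divMod-monic n d monic deg (a ∷ p) with divMod-monic n d monic deg p
  ... | s , r , p≈ , deg-r = u ∷ s , r′ , p≈′ , deg-r′
    where
    u = coeff (a ∷ r) n
    r′ = (a ∷ r) +ₚ -ₚ scale u d
    coeff-r′ : ∀ i → coeff r′ i ≈ coeff (a ∷ r) i - u * coeff d i
    coeff-r′ i = trans (coeff-+ (a ∷ r) (-ₚ scale u d) i)
      (+-congˡ (trans (coeff-neg (scale u d) i) (-‿cong (coeff-scale u d i))))
    p≈′ : (a ∷ p) ≈ₚ ((u ∷ s) *ₚ d) +ₚ r′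
    p≈′ zero    = sym (begin
      coeff (((u ∷ s) *ₚ d) +ₚ r′) 0              ≈⟨ coeff-+ ((u ∷ s) *ₚ d) r′ 0 ⟩
      coeff ((u ∷ s) *ₚ d) 0 + coeff r′ 0         ≈⟨ +-cong (∷*-zero u s d) (coeff-r′ 0) ⟩
      u * coeff d 0 + (a - u * coeff d 0)         ≈⟨ solve 2 (λ a x → x :+ (a :- x) := a) refl _ _ ⟩
      a                                           ∎)
    p≈′ (suc i) = sym (begin
      coeff (((u ∷ s) *ₚ d) +ₚ r′) (suc i)
        ≈⟨ coeff-+ ((u ∷ s) *ₚ d) r′ (suc i) ⟩
      coeff ((u ∷ s) *ₚ d) (suc i) + coeff r′ (suc i)
        ≈⟨ +-cong (∷*-suc u s d i) (coeff-r′ (suc i)) ⟩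
      (u * coeff d (suc i) + coeff (s *ₚ d) i) + (coeff r i - u * coeff d (suc i))
        ≈⟨ solve 3 (λ x y z → (x :+ y) :+ (z :- x) := y :+ z) refl _ _ _ ⟩
      coeff (s *ₚ d) i + coeff r i
        ≈⟨ coeff-+ (s *ₚ d) r i ⟨
      coeff ((s *ₚ d) +ₚ r) i
        ≈⟨ p≈ i ⟨
      coeff p i ∎)
    deg-r′ : DegreeBelow n r′
    deg-r′ i n≤i with ℕₚ.m≤n⇒m<n∨m≡n n≤i
    deg-r′ .n      _ | inj₂ ≡.refl    =
      trans (coeff-r′ n) (trans (+-congˡ (-‿cong (trans (*-congˡ monic) (*-identityʳ u)))) (-‿inverseʳ u))
    deg-r′ (suc i) _ | inj₁ (s≤s n≤i) =
      trans (coeff-r′ (suc i)) (trans (+-cong (deg-r i n≤i) (-‿cong (trans (*-congˡ (deg (suc i) (s≤s n≤i))) (zeroʳ u))))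
        (-‿inverseʳ 0#))

  coeff-drop : ∀ p i → coeff (List.drop 1 p) i ≡ coeff p (suc i)
  coeff-drop []      i = ≡.refl
  coeff-drop (a ∷ p) i = ≡.refl

  *-drop-zero : ∀ g d → coeff (g *ₚ d) 0 ≈ coeff g 0 * coeff d 0
  *-drop-zero []      d = sym (zeroˡ _)
  *-drop-zero (a ∷ g) d = ∷*-zero a g d

  *-drop-suc : ∀ g d i → coeff (g *ₚ d) (suc i) ≈ coeff g 0 * coeff d (suc i) + coeff (List.drop 1 g *ₚ d) i
  *-drop-suc []      d i = sym (trans (+-identityʳ _) (zeroˡ _))
  *-drop-suc (a ∷ g) d i = ∷*-suc a g d i

  -- One step of the algorithm replaces p = g d by (p - g₀ d) / X, which is again d times the tail
  -- of g.
  seriesQuotient-coeff : ∀ m p d g → coeff d 0 ≈ 1# → p ≈ₚ g *ₚ d →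
    ∀ i → i ℕ.< m → coeff (seriesQuotient m p d) i ≈ coeff g i
  seriesQuotient-coeff (suc m) p d g d₀≈1 p≈gd zero    _         =
    trans (p≈gd 0) (trans (*-drop-zero g d) (trans (*-congˡ d₀≈1) (*-identityʳ _)))
  seriesQuotient-coeff (suc m) p d g d₀≈1 p≈gd (suc i) (s≤s i<m) =
    trans (seriesQuotient-coeff m (List.drop 1 p′) d (List.drop 1 g) d₀≈1 tail i i<m)
          (reflexive (coeff-drop g i))
    where
    p′ = p +ₚ -ₚ (const (coeff p 0) *ₚ d)
    p₀≈g₀ = trans (p≈gd 0) (trans (*-drop-zero g d) (trans (*-congˡ d₀≈1) (*-identityʳ _)))
    tail : List.drop 1 p′ ≈ₚ List.drop 1 g *ₚ d
    tail j = begin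
      coeff (List.drop 1 p′) j
        ≡⟨ coeff-drop p′ j ⟩
      coeff p′ (suc j)
        ≈⟨ coeff-+ p _ (suc j) ⟩
      coeff p (suc j) + coeff (-ₚ (const (coeff p 0) *ₚ d)) (suc j)
        ≈⟨ +-cong (trans (p≈gd (suc j)) (*-drop-suc g d j))
                  (trans (coeff-neg (const (coeff p 0) *ₚ d) (suc j)) (-‿cong (trans (const-*ₚ (coeff p 0) d (suc j)) (*-congʳ p₀≈g₀)))) ⟩
      (coeff g 0 * coeff d (suc j) + coeff (List.drop 1 g *ₚ d) j) - coeff g 0 * coeff d (suc j)
        ≈⟨ solve 2 (λ x y → (x :+ y) :- x := y) refl _ _ ⟩
      coeff (List.drop 1 g *ₚ d) j ∎

  seriesQuotient-degree : ∀ m p d → DegreeBelow m (seriesQuotient m p d)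
  seriesQuotient-degree zero    p d i       _         = refl
  seriesQuotient-degree (suc m) p d (suc i) (s≤s m≤i) = seriesQuotient-degree m _ d i m≤i

  coeff-*-top : ∀ e f g d → DegreeBelow (suc e) g → DegreeBelow (suc f) d →
    coeff (g *ₚ d) (e ℕ.+ f) ≈ coeff g e * coeff d f
  coeff-*-top e       f       []      d _     _     = sym (zeroˡ _)
  coeff-*-top zero    zero    (a ∷ g) d _     _     = ∷*-zero a g d
  coeff-*-top zero    (suc f) (a ∷ g) d deg-g _     = trans (∷*-suc a g d f)
    (trans (+-congˡ (*ₚ-cong {g} {[]} {d} {d} (λ i → deg-g (suc i) (s≤s z≤n)) (λ _ → refl) f)) (+-identityʳ _))
  coeff-*-top (suc e) f       (a ∷ g) d deg-g deg-d = trans (∷*-suc a g d (e ℕ.+ f))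
    (trans (+-cong (trans (*-congˡ (deg-d _ (s≤s (ℕₚ.m≤n+m f e)))) (zeroʳ a))
                   (coeff-*-top e f g d (λ i e<i → deg-g (suc i) (s≤s e<i)) deg-d)) (+-identityˡ _))

-- q-Catalan numbers in ℤ[q]

module IntegerPolynomials where
  open Polynomial ℤ.+-*-rawRing using (coeff; _÷_; const; X)
  open PolynomialRing ℤₚ.+-*-commutativeRing using (polynomialRing; const-*ₚ; shift-*ₚ; coeff-+; coeff-neg)
  open Division ℤₚ.+-*-commutativeRing
  open Roots ℤₚ.+-*-commutativeRing using (DegreeBelow)
  open CommutativeRing polynomialRing hiding (zero)
  open Algebra.Properties.Ring ring
  open RingLemmas polynomialRing
  open QBinomial polynomialRing X
  open Algebra.Properties.Semiring.Exp semiring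

  leadingTerm : ∀ p → p ≈ 0# ⊎ ∃ λ e → coeff p e ≢ + 0 × DegreeBelow (suc e) p
  leadingTerm []      = inj₁ (λ _ → ≡.refl)
  leadingTerm (a ∷ p) with leadingTerm p
  ... | inj₂ (e , pₑ≢0 , deg) = inj₂ (suc e , pₑ≢0 , λ { (suc i) (s≤s e<i) → deg i e<i })
  ... | inj₁ p≈0 with a ℤₚ.≟ + 0
  ...   | yes a≡0 = inj₁ (λ { zero → a≡0 ; (suc i) → p≈0 i })
  ...   | no  a≢0 = inj₂ (0 , a≢0 , λ { (suc i) _ → p≈0 i })

  -- ℤ has no zero divisors, so degrees add, and d is nonzero because its constant coefficient is 1:
  -- if g had a leading term at e ≥ n, the product would have a nonzero coefficient at e + f ≥ n.
  degree-factor : ∀ n g d → coeff d 0 ≡ + 1 → DegreeBelow n (g * d) → DegreeBelow n g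
  degree-factor n g d d₀≡1 deg i n≤i with leadingTerm g | leadingTerm d
  ... | inj₁ g≈0                | _                        = g≈0 i
  ... | inj₂ _                  | inj₁ d≈0                 with () ← ≡.trans (≡.sym d₀≡1) (d≈0 0)
  ... | inj₂ (e , gₑ≢0 , deg-g) | inj₂ (f , d_f≢0 , deg-d) = deg-g i (ℕₚ.≤-trans e<n n≤i)
    where
    e<n : e ℕ.< n
    e<n = ℕₚ.≰⇒> (λ n≤e → contradiction
      (≡.trans (≡.sym (coeff-*-top e f g d deg-g deg-d)) (deg (e ℕ.+ f) (ℕₚ.≤-trans n≤e (ℕₚ.m≤m+n e f))))
      (λ gd≡0 → Sum.[ gₑ≢0 , d_f≢0 ] (ℤₚ.i*j≡0⇒i≡0∨j≡0 (coeff g e) gd≡0)))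

  coeff-above-length : ∀ p → DegreeBelow (length p) p
  coeff-above-length []      i       _         = ≡.refl
  coeff-above-length (a ∷ p) (suc i) (s≤s n≤i) = coeff-above-length p i n≤i

  -- Below `length p` the series algorithm yields the coefficients of g; from there on the truncated
  -- list has none and, by `degree-factor`, neither has g.
  ÷-unique : ∀ p d g → coeff d 0 ≡ + 1 → p ≈ g * d → p ÷ d ≈ g
  ÷-unique p d g d₀≡1 p≈gd i with i ℕₚ.<? length p
  ... | yes i<n = seriesQuotient-coeff (length p) p d g d₀≡1 p≈gd i i<n
  ... | no  i≮n = ≡.trans (seriesQuotient-degree (length p) p d i n≤i) (≡.sym
    (degree-factor (length p) g d d₀≡1 (λ j n≤j → ≡.trans (≡.sym (p≈gd j)) (coeff-above-length p j n≤j)) i n≤i))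
    where n≤i = ℕₚ.≮⇒≥ i≮n

  -- The case n = 0 of `degree-factor`, where the degree bound says that g - h is zero.
  *-cancelʳ : ∀ d {g h} → coeff d 0 ≡ + 1 → g * d ≈ h * d → g ≈ h
  *-cancelʳ d {g} {h} d₀≡1 gd≈hd = x-y≈0⇒x≈y {g} {h} (λ i → degree-factor 0 (g - h) d d₀≡1
    (λ j _ → trans {(g - h) * d} {g * d - h * d} {0#} ([y-z]x≈yx-zx d g h) (x≈y⇒x-y≈0 {g * d} {h * d} gd≈hd) j) i z≤n)

  coeff-X*-suc : ∀ p i → coeff (X * p) (suc i) ≡ coeff p i
  coeff-X*-suc p i = ≡.trans (shift-*ₚ (const (+ 1)) p (suc i)) (≡.trans (const-*ₚ (+ 1) p i) (ℤₚ.*-identityˡ _))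

  coeff-X*-zero : ∀ p → coeff (X * p) 0 ≡ + 0
  coeff-X*-zero p = shift-*ₚ (const (+ 1)) p 0

  X-cancel : ∀ {p r} → X * p ≈ X * r → p ≈ r
  X-cancel {p} {r} e i = ≡.trans (≡.sym (coeff-X*-suc p i)) (≡.trans (e (suc i)) (coeff-X*-suc r i))

  coeff-1-X* : ∀ p → coeff (1# - X * p) 0 ≡ + 1
  coeff-1-X* p = ≡.trans (coeff-+ 1# (- (X * p)) 0)
    (≡.cong (ℤ._+_ (+ 1)) (≡.trans (coeff-neg (X * p) 0) (≡.cong ℤ.-_ (coeff-X*-zero p))))

  coeff-pochhammer : ∀ n → coeff (qPochhammer n) 0 ≡ + 1
  coeff-pochhammer zero    = ≡.refl
  coeff-pochhammer (suc n) = ≡.trans (qPochhammer-suc n 0) (≡.trans (*-drop-zero (qPochhammer n) (1# - X * X ^ n))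
    (≡.cong₂ ℤ._*_ (coeff-pochhammer n) (coeff-1-X* (X ^ n))))

  open Regular (λ {p} {r} → X-cancel {p} {r})

  gaussianBinomial≈ : ∀ n k → k ℕ.≤ n → gaussianBinomial n k ≈ qbinom n k
  gaussianBinomial≈ n k k≤n with k ℕₚ.≤? n
  ... | no  k≰n = contradiction k≤n k≰n
  ... | yes _   = ÷-unique (qPochhammer n) (qPochhammer k * qPochhammer (n ℕ.∸ k)) (qbinom n k)
    (≡.trans (*-drop-zero (qPochhammer k) (qPochhammer (n ℕ.∸ k)))
             (≡.cong₂ ℤ._*_ (coeff-pochhammer k) (coeff-pochhammer (n ℕ.∸ k))))
    (sym {qbinom n k * (qPochhammer k * qPochhammer (n ℕ.∸ k))} {qPochhammer n}
      (≡.subst (λ m → qbinom m k * (qPochhammer k * qPochhammer (n ℕ.∸ k)) ≈ qPochhammer m)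
               (ℕₚ.m+[n∸m]≡n k≤n) (qbinom-pochhammer k (n ℕ.∸ k))))

  qInteger≈ : ∀ n → qInteger n ≈ ∑ n (X ^_)
  qInteger≈ n = ÷-unique (1# - X ^ n) (1# - X) (∑ n (X ^_)) ≡.refl
    (sym {∑ n (X ^_) * (1# - X)} {1# - X ^ n} (geometric n))

  coeff-qInteger : ∀ n → coeff (qInteger (suc n)) 0 ≡ + 1
  coeff-qInteger n = begin
    coeff [n] 0                                ≡⟨ ℤₚ.*-identityʳ _ ⟨
    coeff [n] 0 ℤ.* coeff (1# - X) 0           ≡⟨ *-drop-zero [n] (1# - X) ⟨
    coeff ([n] * (1# - X)) 0                   ≡⟨ qInteger-geometric 0 ⟩
    coeff (1# - X ^ suc n) 0                   ≡⟨ coeff-1-X* (X ^ n) ⟩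
    + 1                                        ∎
    where
    open ≡.≡-Reasoning
    [n] = qInteger (suc n)
    qInteger-geometric : [n] * (1# - X) ≈ 1# - X ^ suc n
    qInteger-geometric = trans {[n] * (1# - X)} {∑ (suc n) (X ^_) * (1# - X)} {1# - X ^ suc n}
      (*-congʳ {1# - X} {[n]} {∑ (suc n) (X ^_)} (qInteger≈ (suc n))) (geometric (suc n))

  -- `catalan-difference` gives C [n+1] (1 - q) = binom(2n, n) (1 - q); cancelling 1 - q exhibits C
  -- as the quotient by [n+1].
  qCatalan≈ : ∀ n → qCatalan n ≈ central n 0 - X * central n 1
  qCatalan≈ n = ÷-unique (gaussianBinomial (2 ℕ.* n) n) (qInteger (suc n)) C (coeff-qInteger n)
    (trans {gaussianBinomial (2 ℕ.* n) n} {central n 0} {C * qInteger (suc n)}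
      -- `2 ℕ.* n` computes to n + (n + 0), whereas `central` is written with n + n.
      (≡.subst (λ m → gaussianBinomial (n ℕ.+ m) n ≈ central n 0) (≡.sym (ℕₚ.+-identityʳ n))
               (gaussianBinomial≈ (n ℕ.+ n) n (ℕₚ.m≤m+n n n)))
      (*-cancelʳ (1# - X) {central n 0} {C * qInteger (suc n)} ≡.refl
        (sym {C * qInteger (suc n) * (1# - X)} {central n 0 * (1# - X)} (catalan-difference n {qInteger (suc n)}
          (trans {qInteger (suc n) * (1# - X)} {∑ (suc n) (X ^_) * (1# - X)} {1# - X ^ suc n}
            (*-congʳ {1# - X} {qInteger (suc n)} {∑ (suc n) (X ^_)} (qInteger≈ (suc n))) (geometric (suc n)))))))
    where C = central n 0 - X * central n 1

residue-0 : ∀ n → n % 3 ≡ 0 → residue n ≡ ℤ[q].q ℤ[q].^ (n / 3)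
residue-0 n eq with n % 3
residue-0 n ≡.refl | 0 = ≡.refl

residue-1 : ∀ n → n % 3 ≡ 1 → residue n ≡ ℤ[q].q ℤ[q].^ (n / 3)
residue-1 n eq with n % 3
residue-1 n ≡.refl | 1 = ≡.refl

residue-2 : ∀ n → n % 3 ≡ 2 → residue n ≡ ℤ[q].- ℤ[q].1# ℤ[q].- ℤ[q].q ℤ[q].^ ((2 ℕ.* n ℕ.∸ 1) / 3)
residue-2 n eq with n % 3
residue-2 n ≡.refl | 2 = ≡.refl

-- Reduction modulo Φₙ

module OverField {c ℓ₁ ℓ₂} (K : HeytingField c ℓ₁ ℓ₂) (char0 : CharacteristicZero K) where
  open HeytingField K using (_#_; #-irrefl; #⇒invertible; heytingCommutativeRing)
  open HeytingCommutativeRing heytingCommutativeRing using (commutativeRing)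
  open CommutativeRing commutativeRing hiding (zero)
  open Algebra.Properties.Ring ring
  open Algebra.Properties.Semiring.Exp semiring
  open Algebra.Properties.Semiring.Mult.TCOptimised semiring using (×ᵤ≈×)
  open RingLemmas commutativeRing
  open IntegerImage commutativeRing using (⟦_⟧; ⟦+⟧; ⟦*⟧; ⟦-⟧; module Solver)
  open Roots commutativeRing using
    (Regular; vanishing; rootProduct; eval-rootProduct; rootProduct-degree; rootProduct-monic; id-isHomomorphism)
  open Solver using (solve; _:=_; _:+_; _:-_; _:*_; :-_; con)
  private
    module ℤ[X] where
      open Polynomial ℤ.+-*-rawRing public using (coeff; X)
      open PolynomialRing ℤₚ.+-*-commutativeRing public using (polynomialRing)
      open CommutativeRing polynomialRing public hiding (zero)
    module K[X] where
      open Polynomial rawRing public using (coeff)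

  -- `fromℤ` uses plain multiples of 1, `⟦_⟧` optimised ones; identifying them transfers the
  -- homomorphism laws of `⟦_⟧`.
  fromℤ≈⟦⟧ : ∀ i → fromℤ K i ≈ ⟦ i ⟧
  fromℤ≈⟦⟧ (+ n)      = ×ᵤ≈× n 1#
  fromℤ≈⟦⟧ (-[1+ n ]) = -‿cong (×ᵤ≈× (suc n) 1#)

  fromℤ-isHomomorphism : IsHomomorphism ℤₚ.+-*-commutativeRing commutativeRing (fromℤ K)
  fromℤ-isHomomorphism = mkIsHomomorphism {R = ℤₚ.+-*-commutativeRing} {S = commutativeRing}
    (λ { ≡.refl → refl })
    (λ i j → trans (fromℤ≈⟦⟧ (i ℤ.+ j)) (trans (⟦+⟧ i j) (sym (+-cong (fromℤ≈⟦⟧ i) (fromℤ≈⟦⟧ j)))))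
    (λ i j → trans (fromℤ≈⟦⟧ (i ℤ.* j)) (trans (⟦*⟧ i j) (sym (*-cong (fromℤ≈⟦⟧ i) (fromℤ≈⟦⟧ j)))))
    (λ i → trans (fromℤ≈⟦⟧ (ℤ.- i)) (trans (⟦-⟧ i) (sym (-‿cong (fromℤ≈⟦⟧ i)))))
    refl (fromℤ≈⟦⟧ (+ 1))

  fromℤ≈0⇒≡0 : ∀ i → fromℤ K i ≈ 0# → i ≡ + 0
  fromℤ≈0⇒≡0 (+ zero)    _    = ≡.refl
  fromℤ≈0⇒≡0 (+ suc n)   eq   = contradiction (char0 (suc n)) (#-irrefl eq)
  fromℤ≈0⇒≡0 (-[1+ n ])  eq   = contradiction (char0 (suc n))
    (#-irrefl (trans (sym (-‿involutive _)) (trans (-‿cong eq) -0#≈0#)))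

  fromℤ-injective : ∀ i j → fromℤ K i ≈ fromℤ K j → i ≡ j
  fromℤ-injective i j eq = ℤₚ.i-j≡0⇒i≡j i j (fromℤ≈0⇒≡0 (i ℤ.- j)
    (trans (φ.+-homo i (ℤ.- j)) (trans (+-congˡ (φ.-‿homo j)) (x≈y⇒x-y≈0 eq))))
    where module φ = Homomorphism {R = ℤₚ.+-*-commutativeRing} {S = commutativeRing} fromℤ-isHomomorphism

  coeff-map-fromℤ : ∀ p i → K[X].coeff (List.map (fromℤ K) p) i ≡ fromℤ K (ℤ[X].coeff p i)
  coeff-map-fromℤ []      i       = ≡.refl
  coeff-map-fromℤ (a ∷ p) zero    = ≡.refl
  coeff-map-fromℤ (a ∷ p) (suc i) = coeff-map-fromℤ p i

  #⇒regular : ∀ {x y} → x # y → Regular (x - y)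
  #⇒regular x#y {z} [x-y]z≈0 with #⇒invertible x#y
  ... | u , u[x-y]≈1 , _ = trans (sym (trans (sym (*-assoc u _ z)) (trans (*-congʳ u[x-y]≈1) (*-identityˡ z))))
    (trans (*-congˡ [x-y]z≈0) (zeroʳ u))

  module AtPoint (x : Carrier) where
    open Evaluation {R = ℤₚ.+-*-commutativeRing} {S = commutativeRing} fromℤ-isHomomorphism x public

    private module Kx = Evaluation {R = commutativeRing} {S = commutativeRing} id-isHomomorphism x

    eval-map-fromℤ : ∀ p → Kx.eval (List.map (fromℤ K) p) ≡ eval p
    eval-map-fromℤ []      = ≡.refl
    eval-map-fromℤ (a ∷ p) = ≡.cong (λ y → fromℤ K a + x * y) (eval-map-fromℤ p)

    private module ev = Homomorphism {R = ℤ[X].polynomialRing} {S = commutativeRing} eval-isHomomorphism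

    module _ (ν : ℕ) (x^n≈1 : x ^ suc ν ≈ 1#)
      (regular : ∀ i → 0 ℕ.< i → i ℕ.< suc ν → Regular (1# - x ^ i)) where

      private
        n = suc ν
        -- This equals x only up to `≈`; working at `eval X` lets `qbinom-homo` apply without
        -- rewriting.
        q = eval ℤ[X].X

        q^≈x^ : ∀ i → q ^ i ≈ x ^ i
        q^≈x^ i = ^-congˡ i eval-X

      open QBinomial commutativeRing q using (central; module AtRootOfUnity)
      open AtRootOfUnity ν (trans (q^≈x^ n) x^n≈1)
        (λ i 0<i i<n {y} eq → regular i 0<i i<n {y} (trans (*-congʳ (+-congˡ (-‿cong (sym (q^≈x^ i))))) eq))

      eval-qCatalan : ∀ k → eval (qCatalan k) ≈ central k 0 - q * central k 1
      eval-qCatalan k = begin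
        eval (qCatalan k)
          ≈⟨ eval-cong (qCatalan k) (ℤ[X]q.central k 0 ℤ[X].- ℤ[X].X ℤ[X].* ℤ[X]q.central k 1) (IntegerPolynomials.qCatalan≈ k) ⟩
        eval (ℤ[X]q.central k 0 ℤ[X].- ℤ[X].X ℤ[X].* ℤ[X]q.central k 1)
          ≈⟨ trans (eval-+ (ℤ[X]q.central k 0) (ℤ[X].- (ℤ[X].X ℤ[X].* ℤ[X]q.central k 1))) (+-congˡ (trans (eval-neg (ℤ[X].X ℤ[X].* ℤ[X]q.central k 1)) (-‿cong (eval-* ℤ[X].X (ℤ[X]q.central k 1))))) ⟩
        eval (ℤ[X]q.central k 0) - q * eval (ℤ[X]q.central k 1)
          ≈⟨ +-cong (ev.qbinom-homo ℤ[X].X (k ℕ.+ k) k) (-‿cong (*-congˡ (ev.qbinom-homo ℤ[X].X (k ℕ.+ k) (suc k)))) ⟩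
        central k 0 - q * central k 1 ∎
        where
        open Relation.Binary.Reasoning.Setoid setoid
        module ℤ[X]q = QBinomial ℤ[X].polynomialRing ℤ[X].X

      eval-catalanSum : eval (catalanSum n) ≈ catalanValue
      eval-catalanSum = trans (ev.∑-homo n (λ k → ℤ[q]._*_ (ℤ[q]._^_ ℤ[X].X k) (qCatalan k)))
        (trans (∑-cong n (λ k → trans (eval-* (ℤ[q]._^_ ℤ[X].X k) (qCatalan k)) (*-cong (ev.^-homo ℤ[X].X k) (eval-qCatalan k)))) ∑-catalan)

      eval-residue : eval (residue n) ≈ catalanValue
      eval-residue = go (n % 3) ≡.refl (m%n<n n 3)
        where
        m = n / 3
        n≡ : ∀ {r} → n % 3 ≡ r → r ℕ.+ m ℕ.* 3 ≡ n
        n≡ ≡.refl = ≡.sym (m≡m%n+[m/n]*n n 3)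
        -- As n > 0, m = 0 is impossible here, so the predecessor that `catalanValue-3` asks for
        -- exists.
        positive : ∀ m → m ℕ.* 3 ≡ n → catalanValue ≈ q ^ m
        positive (suc m) eq = catalanValue-3 m eq
        -- With n = 3m + 2 one has 2n - 1 = 3 (2m + 1), so the division is exact.
        exponent : n % 3 ≡ 2 → (2 ℕ.* n ℕ.∸ 1) / 3 ≡ suc (2 ℕ.* m)
        exponent r = ≡.trans
          (≡.cong (λ k → (2 ℕ.* k ℕ.∸ 1) / 3) (≡.sym (n≡ r)))
          (≡.trans (≡.cong (λ k → (k ℕ.∸ 1) / 3) (double m)) (m*n/n≡m (suc (2 ℕ.* m)) 3))
          where
          double : ∀ m → 2 ℕ.* (2 ℕ.+ m ℕ.* 3) ≡ suc (suc (2 ℕ.* m) ℕ.* 3)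
          double = ℕSolver.solve-∀
        go : ∀ r → n % 3 ≡ r → r ℕ.< 3 → eval (residue n) ≈ catalanValue
        go 0 r _ = trans (reflexive (≡.cong eval (residue-0 n r))) (trans (ev.^-homo ℤ[X].X m) (sym (positive m (n≡ r))))
        go 1 r _ = trans (reflexive (≡.cong eval (residue-1 n r))) (trans (ev.^-homo ℤ[X].X m) (sym (catalanValue-1 m (n≡ r))))
        go 2 r _ = begin
          eval (residue n)
            ≡⟨ ≡.cong eval (≡.trans (residue-2 n r) (≡.cong (λ k → ℤ[q]._-_ (ℤ[q].-_ ℤ[q].1#) (ℤ[q]._^_ ℤ[X].X k)) (exponent r))) ⟩
          eval (ℤ[q]._-_ (ℤ[q].-_ ℤ[q].1#) (ℤ[q]._^_ ℤ[X].X k))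
            ≈⟨ trans (eval-+ (ℤ[q].-_ ℤ[q].1#) (ℤ[q].-_ (ℤ[q]._^_ ℤ[X].X k))) (+-cong (trans (eval-neg ℤ[q].1#) (-‿cong ev.1#-homo))
                 (trans (eval-neg (ℤ[q]._^_ ℤ[X].X k)) (-‿cong (ev.^-homo ℤ[X].X k)))) ⟩
          - 1# - q ^ k
            ≈⟨ catalanValue-2 m (n≡ r) ⟨
          catalanValue ∎
          where
          open Relation.Binary.Reasoning.Setoid setoid
          k = suc (2 ℕ.* m)
        go (suc (suc (suc _))) _ (s≤s (s≤s (s≤s ())))

      eval-difference : eval (ℤ[q]._-_ (catalanSum n) (residue n)) ≈ 0#
      eval-difference = trans (eval-+ (catalanSum n) (ℤ[q].-_ (residue n)))
        (trans (+-congˡ (eval-neg (residue n))) (x≈y⇒x-y≈0 (trans eval-catalanSum (sym eval-residue))))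

  module _ (ν : ℕ) (ζ : Carrier) (isPrimitive : IsPrimitiveRoot K (suc ν) ζ) where

    private
      n = suc ν

      ζ^n≈1 : ζ ^ n ≈ 1#
      ζ^n≈1 = proj₁ isPrimitive

      ζ^*n : ∀ b → ζ ^ (b ℕ.* n) ≈ 1#
      ζ^*n b = trans (reflexive (≡.cong (ζ ^_) (ℕₚ.*-comm b n))) (^-*-unit ζ n b ζ^n≈1)

      ζ^% : ∀ a → ζ ^ a ≈ ζ ^ (a % n)
      ζ^% a = begin
        ζ ^ a                            ≡⟨ ≡.cong (ζ ^_) (m≡m%n+[m/n]*n a n) ⟩
        ζ ^ (a % n ℕ.+ a / n ℕ.* n)      ≈⟨ ^-homo-* ζ (a % n) (a / n ℕ.* n) ⟩
        ζ ^ (a % n) * ζ ^ (a / n ℕ.* n)  ≈⟨ *-congˡ (ζ^*n (a / n)) ⟩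
        ζ ^ (a % n) * 1#                 ≈⟨ *-identityʳ _ ⟩
        ζ ^ (a % n)                      ∎
        where open Relation.Binary.Reasoning.Setoid setoid

      regular-cong : ∀ {x y} → x ≈ y → Regular x → Regular y
      regular-cong x≈y reg yz≈0 = reg (trans (*-congʳ x≈y) yz≈0)

      regular-neg : ∀ {x} → Regular x → Regular (- x)
      regular-neg reg {z} eq = reg (trans (sym (-‿involutive _)) (trans (-‿cong (trans (-‿distribˡ-* _ z) eq)) -0#≈0#))

      regular-* : ∀ {x y} → Regular x → Regular y → Regular (x * y)
      regular-* reg-x reg-y eq = reg-y (reg-x (trans (sym (*-assoc _ _ _)) eq))

      regular-ζ^ : ∀ a → Regular (ζ ^ a)
      regular-ζ^ zero    eq = trans (sym (*-identityˡ _)) eq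
      regular-ζ^ (suc a) = regular-* regular-ζ (regular-ζ^ a)
        where
        regular-ζ : Regular ζ
        regular-ζ {z} ζz≈0 = begin
          z                 ≈⟨ *-identityˡ z ⟨
          1# * z            ≈⟨ *-congʳ ζ^n≈1 ⟨
          ζ * ζ ^ ν * z     ≈⟨ solve 3 (λ a b z → a :* b :* z := b :* (a :* z)) refl ζ (ζ ^ ν) z ⟩
          ζ ^ ν * (ζ * z)   ≈⟨ *-congˡ ζz≈0 ⟩
          ζ ^ ν * 0#        ≈⟨ zeroʳ _ ⟩
          0#                ∎
          where open Relation.Binary.Reasoning.Setoid setoid

      regular-ζ^-1 : ∀ a → 0 ℕ.< a → a ℕ.< n → Regular (ζ ^ a - 1#)
      regular-ζ^-1 a 0<a a<n = #⇒regular (proj₂ isPrimitive a 0<a a<n)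

      -- Factor ζ^b - ζ^a as ζ^a (ζ^(b-a) - 1): a unit times a difference that primitivity makes
      -- invertible.
      regular-ζ^-ζ^ : ∀ {a b} → a ℕ.< b → b ℕ.< n → Regular (ζ ^ b - ζ ^ a)
      regular-ζ^-ζ^ {a} {b} a<b b<n = regular-cong factor
        (regular-* (regular-ζ^ a) (regular-ζ^-1 (b ℕ.∸ a) (ℕₚ.m<n⇒0<n∸m a<b) (ℕₚ.≤-<-trans (ℕₚ.m∸n≤m b a) b<n)))
        where
        open Relation.Binary.Reasoning.Setoid setoid
        factor : ζ ^ a * (ζ ^ (b ℕ.∸ a) - 1#) ≈ ζ ^ b - ζ ^ a
        factor = begin
          ζ ^ a * (ζ ^ (b ℕ.∸ a) - 1#)       ≈⟨ solve 2 (λ x y → x :* (y :- con (+ 1)) := x :* y :- x) refl _ _ ⟩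
          ζ ^ a * ζ ^ (b ℕ.∸ a) - ζ ^ a      ≈⟨ +-congʳ (^-homo-* ζ a (b ℕ.∸ a)) ⟨
          ζ ^ (a ℕ.+ (b ℕ.∸ a)) - ζ ^ a      ≡⟨ ≡.cong (λ k → ζ ^ k - ζ ^ a) (ℕₚ.m+[n∸m]≡n (ℕₚ.<⇒≤ a<b)) ⟩
          ζ ^ b - ζ ^ a                      ∎

      -- ζ^m is again a primitive root: its i-th power is ζ^(mi mod n), and if n divided mi,
      -- coprimality would give n ∣ i, impossible for 0 < i < n.
      regular-coprime : ∀ m → gcd m n ≡ 1 → ∀ i → 0 ℕ.< i → i ℕ.< n → Regular (1# - (ζ ^ m) ^ i)
      regular-coprime m gcd≡1 i@(suc _) 0<i i<n = regular-cong
        (trans (solve 1 (λ x → :- (x :- con (+ 1)) := con (+ 1) :- x) refl _)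
          (+-congˡ (-‿cong (sym (trans (^-assocʳ ζ m i) (ζ^% (m ℕ.* i)))))))
        (regular-neg (regular-ζ^-1 (m ℕ.* i % n) (ℕₚ.n≢0⇒n>0 mi%n≢0) (m%n<n (m ℕ.* i) n)))
        where
        mi%n≢0 : m ℕ.* i % n ≢ 0
        mi%n≢0 eq = ℕₚ.<⇒≱ i<n (∣⇒≤ (coprime-divisor (Coprimality.sym (gcd≡1⇒coprime {m} gcd≡1)) (m%n≡0⇒n∣m (m ℕ.* i) n eq)))

      units : List ℕ
      units = filter (λ m → gcd m n ℕₚ.≟ 1) (upTo n)

      -- The exponents in `upTo n` ascend, so each pair has the order that `regular-ζ^-ζ^` expects;
      -- filtering preserves this.
      roots-distinct : AllPairs (λ α β → Regular (β - α)) (List.map (ζ ^_) units)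
      roots-distinct = AllPairsₚ.map⁺ (AllPairsₚ.filter⁺ (λ m → gcd m n ℕₚ.≟ 1)
        (AllPairsₚ.applyUpTo⁺₁ (λ m → m) n (λ {i} {j} i<j j<n {z} → regular-ζ^-ζ^ i<j j<n {z})))

    module _ (Φ : ℤ[q]) (isCyclotomic : IsCyclotomic K (suc ν) ζ Φ) where

      private
        d = length units
        P = ℤ[q]._-_ (catalanSum n) (residue n)

        fromℤ-coeff-Φ : ∀ i → fromℤ K (ℤ[X].coeff Φ i) ≈ K[X].coeff (rootProduct (ζ ^_) units) i
        fromℤ-coeff-Φ i = trans (reflexive (≡.sym (coeff-map-fromℤ Φ i))) (isCyclotomic i)

        -- The leading coefficient is computed in K and pulled back by injectivity of `fromℤ`, so
        -- that division by Φ can be done in ℤ[q].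
        Φ-monic : ℤ[X].coeff Φ d ≡ + 1
        Φ-monic = fromℤ-injective _ _ (trans (fromℤ-coeff-Φ d)
          (trans (rootProduct-monic (ζ ^_) units) (sym (fromℤ≈⟦⟧ (+ 1)))))

        Φ-degree : ∀ i → d ℕ.< i → ℤ[X].coeff Φ i ≡ + 0
        Φ-degree i d<i = fromℤ≈0⇒≡0 _ (trans (fromℤ-coeff-Φ i) (rootProduct-degree (ζ ^_) units i d<i))

      cyclotomic-divides : ℤ[q]._∣_ Φ P
      -- Dividing over ℤ makes the quotient integral at once; only the remainder has to be studied
      -- over K.
      cyclotomic-divides with Division.divMod-monic ℤₚ.+-*-commutativeRing d Φ Φ-monic Φ-degree P
      ... | s , r , P≈ , deg-r = record { quotient = s ; equality = λ i → ≡.sym (≡.trans (P≈ i) (≡.trans (coeff-+ (s ℤ[X].* Φ) r i)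
            (≡.trans (≡.cong (ℤ._+_ (ℤ[X].coeff (s ℤ[X].* Φ) i)) (r≈0 i)) (ℤₚ.+-identityʳ _)))) }
        where
        open PolynomialRing ℤₚ.+-*-commutativeRing using (coeff-+)
        r-root : ∀ {m} → m ∈ units → gcd m n ≡ 1 → Roots.At.eval commutativeRing (ζ ^ m) (List.map (fromℤ K) r) ≈ 0#
        r-root {m} m∈ gcd≡1 = begin
          Roots.At.eval commutativeRing ξ (List.map (fromℤ K) r)
            ≡⟨ eval-map-fromℤ r ⟩
          eval r
            -- Since Φ(ξ) = 0, adding s Φ to r leaves the value at ξ unchanged and turns r into P.
            ≈⟨ solve 2 (λ s r → r := s :* con (+ 0) :+ r) refl (eval s) (eval r) ⟩
          eval s * 0# + eval r
            ≈⟨ +-congʳ (*-congˡ Φ-root) ⟨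
          eval s * eval Φ + eval r
            ≈⟨ +-congʳ (eval-* s Φ) ⟨
          eval (s ℤ[X].* Φ) + eval r
            ≈⟨ eval-+ (s ℤ[X].* Φ) r ⟨
          eval ((s ℤ[X].* Φ) ℤ[X].+ r)
            ≈⟨ eval-cong P ((s ℤ[X].* Φ) ℤ[X].+ r) P≈ ⟨
          eval P
            ≈⟨ eval-difference ν ξ^n≈1 (regular-coprime m gcd≡1) ⟩
          0# ∎
          where
          open Relation.Binary.Reasoning.Setoid setoid
          ξ = ζ ^ m
          open AtPoint ξ
          ξ^n≈1 : ξ ^ n ≈ 1#
          ξ^n≈1 = trans (^-assocʳ ζ m n) (ζ^*n m)
          Φ-root : eval Φ ≈ 0#
          Φ-root = begin
            eval Φ
              ≡⟨ eval-map-fromℤ Φ ⟨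
            Roots.At.eval commutativeRing ξ (List.map (fromℤ K) Φ)
              ≈⟨ Roots.At.eval-cong commutativeRing ξ (List.map (fromℤ K) Φ) (rootProduct (ζ ^_) units) isCyclotomic ⟩
            Roots.At.eval commutativeRing ξ (rootProduct (ζ ^_) units)
              ≈⟨ eval-rootProduct (ζ ^_) m∈ ⟩
            0# ∎
        r≈0 : ∀ i → ℤ[X].coeff r i ≡ + 0
        r≈0 i = fromℤ≈0⇒≡0 _ (trans (reflexive (≡.sym (coeff-map-fromℤ r i)))
          (vanishing (List.map (ζ ^_) units) roots-distinct (List.map (fromℤ K) r)
            (λ j d≤j → trans (reflexive (coeff-map-fromℤ r j)) (reflexive (≡.cong (fromℤ K)
              (deg-r j (ℕₚ.≤-trans (ℕₚ.≤-reflexive (≡.sym (Listₚ.length-map (ζ ^_) units))) d≤j)))))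
            (Allₚ.map⁺ (All.tabulate (λ m∈ → r-root m∈
              (All.lookup (Allₚ.all-filter (λ m → gcd m n ℕₚ.≟ 1) (upTo n)) m∈)))) i))

theorem6p1 : (n : ℕ) → .{{_ : NonZero n}} → ∀ {c ℓ₁ ℓ₂} (K : HeytingField c ℓ₁ ℓ₂) → CharacteristicZero K →
    (ζ : HeytingField.Carrier K) → IsPrimitiveRoot K n ζ →
    (Φ : ℤ[q]) → IsCyclotomic K n ζ Φ →
    catalanSum n ≡ residue n [mod Φ ]
theorem6p1 (suc ν) K char0 ζ isPrimitive Φ isCyclotomic =
  OverField.cyclotomic-divides K char0 ν ζ isPrimitive Φ isCyclotomic
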